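{- Let $A\in\mathbb{Z}$ with $A\equiv 1\pmod 4$, and for an integer $n\ge 3$ let \[\mathcal{F}_{n,A,A}(x)=x^{2^n}+Ax^{3\cdot 2^{n-2}}+Ax^{2^{n-1}}+Ax^{2^{n-2}}+1.\] Then $\mathcal{F}_{n,A,A}(x)$ is irreducible over $\mathbb{Q}$ if and only if $A\neq 1$. -}

module Defs where

open import Data.Nat using (ℕ; zero; suc; _^_; _*_; _∸_; _≤_)
open import Data.Integer using (ℤ; +_)
open import Data.Rational using (ℚ; 0ℚ; _/_) renaming (_+_ to _+ℚ_; _*_ to _*ℚ_)
open import Data.List using (List; []; _∷_; map; replicate; _++_; [_])
open import Data.Product using (_×_)
open import Data.Sum using (_⊎_)
open import Relation.Binary.PropositionalEquality using (_≡_)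
open import Relation.Nullary using (¬_)

-- Polynomials over ℚ as coefficient lists, lowest degree first
-- (trailing zeros allowed; equality is coefficientwise).
Poly : Set
Poly = List ℚ

coeff : Poly → ℕ → ℚ
coeff []      _       = 0ℚ
coeff (a ∷ p) zero    = a
coeff (a ∷ p) (suc i) = coeff p i

_+P_ : Poly → Poly → Poly
[]      +P q       = q
(a ∷ p) +P []      = a ∷ p
(a ∷ p) +P (b ∷ q) = (a +ℚ b) ∷ (p +P q)

_*P_ : Poly → Poly → Poly
[]      *P q = []
(a ∷ p) *P q = map (a *ℚ_) q +P (0ℚ ∷ (p *P q))

_≈P_ : Poly → Poly → Set
p ≈P q = ∀ i → coeff p i ≡ coeff q i

monomial : ℚ → ℕ → Poly
monomial c k = replicate k 0ℚ ++ [ c ]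

IsConstant : Poly → Set
IsConstant p = ∀ i → coeff p (suc i) ≡ 0ℚ

-- irreducible in ℚ[x]: not a constant (i.e. not zero and not a unit),
-- and every factorisation has a constant (unit) factor.
Irreducible : Poly → Set
Irreducible f = ¬ IsConstant f × (∀ g h → f ≈P (g *P h) → IsConstant g ⊎ IsConstant h)

toℚ : ℤ → ℚ
toℚ z = z / 1

F : ℕ → ℤ → Poly
F n A = monomial (toℚ (+ 1)) (2 ^ n)
     +P (monomial (toℚ A) (3 * 2 ^ (n ∸ 2))
     +P (monomial (toℚ A) (2 ^ (n ∸ 1))
     +P (monomial (toℚ A) (2 ^ (n ∸ 2))
     +P monomial (toℚ (+ 1)) 0)))

{-# OPTIONS --safe #-}
module Submission where

-- With g(y) = y⁴ + A y³ + A y² + A y + 1 the polynomial in question is g(x^(2^k)), k = n − 2 ≥ 1,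
-- so it suffices to study the passage from f(x) to f(x²). Write p(x) = a(x²) + x b(x²) and let
-- norm p = a² − x b², so that (norm p)(x²) = p(x) p(−x). If f(x²) = p q, then
-- norm p · norm q = f², and irreducibility of f forces one factor to be constant or norm p = f.
--
-- For f = g, comparing coefficients in norm p = g leaves A = 1 as the only odd solution.
-- For f(x) = h(x²), the odd part of norm p = f shows that b² is even, hence b is even and f ≡ a²
-- modulo 4. Being a square modulo 4 descends from h(x²) to h, finally to g, whose x³-coefficient
-- A would have to be even.
--
-- Irreducibility of g itself is a parity argument on its factors, and Gauss's lemma moves between
-- ℤ and ℚ. For A = 1 one has Φ₅(x²) = Φ₅(x) Φ₅(−x).

-- The step from f(x) to f(x²) is Capelli's criterion in disguise: if θ is a root of the irreducible
-- f, a proper factorisation of f(x²) makes θ a square in ℚ(θ), and f is then, up to sign, the norm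
-- of some a + b√x. Working with `norm` keeps everything in ℤ[x], without field extensions. The
-- price is that f must be known to be prime, which is what the Euclidean algorithm below provides.
--
-- The two kinds of level need different arguments. For A = 1 the quartic Φ₅ is a norm, namely of
-- itself, so no congruence that admits A = 1 can exclude norm p = g, and the coefficient equations
-- have to be solved over ℤ. After one substitution f has no odd part, and only then does comparing
-- odd parts say anything about the parity of b².
--
-- All the polynomials f have constant term 1. Integers and f itself can therefore be cancelled
-- coefficient by coefficient from the low end, which suits an encoding that starts at the constant
-- term and stores no degree.

open import Defs
open import Algebra.Bundles using (CommutativeRing)
open import Algebra.Properties.CommutativeSemigroup using (interchange)
import Algebra.Solver.Ring.AlmostCommutativeRing as ACR
open import Data.Integer using (ℤ; +_; -_; _+_; _-_; _*_; 0ℤ; 1ℤ)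
import Data.Integer as ℤ
open import Data.Integer.Divisibility using (_∣_)
open import Data.Integer.Divisibility.Signed
  using (divides; _∣?_; ∣ᵤ⇒∣; ∣⇒∣ᵤ; ∣-trans; 0∣⇒≡0; ∣m∣n⇒∣m+n; ∣m∣n⇒∣m-n; ∣m+n∣m⇒∣n; ∣m+n∣n⇒∣m;
         ∣m⇒∣-m; ∣m⇒∣m*n; ∣n⇒∣m*n; *-cancelʳ-∣)
  renaming (_∣_ to _∣ₛ_)
open import Data.Integer.DivMod using (_%ℕ_; _/ℕ_; n%ℕd<d; a≡a%ℕn+[a/ℕn]*n)
import Data.Integer.Properties as ℤ
open import Data.Integer.Tactic.RingSolver using (solve-∀)
open import Data.List using (List; []; _∷_; map)
open import Data.List.Relation.Unary.All using (All; []; _∷_)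
import Data.Maybe as Maybe
open import Data.Nat using (ℕ; zero; suc; _^_; _∸_; _≤_; _<_; z≤n; s≤s)
import Data.Nat as ℕ
import Data.Nat.Divisibility as ℕ
open import Data.Nat.ListAction using (product)
open import Data.Nat.Primality using (Prime; prime[2]; euclidsLemma; prime⇒nonZero)
open import Data.Nat.Primality.Factorisation using (factorise; PrimeFactorisation)
import Data.Nat.Properties as ℕ
open import Data.Product using (∃; _×_; _,_; proj₁; proj₂)
open import Data.Rational using (mkℚ; 0ℚ; ↥_; ↧_; toℚᵘ) renaming (_+_ to _+ℚ_; _*_ to _*ℚ_)
import Data.Rational.Properties as ℚ
open import Data.Rational.Unnormalised using (mkℚᵘ; *≡*; _≃_)
import Data.Rational.Unnormalised.Properties as ℚᵘ
open import Data.Sum using (_⊎_; inj₁; inj₂)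
import Data.Sum as Sum
open import Function.Bundles using (_⇔_; mk⇔)
open import Level using (0ℓ)
open import Relation.Binary.PropositionalEquality
  using (_≡_; _≢_; refl; sym; trans; cong; cong₂; subst; module ≡-Reasoning)
open import Relation.Nullary using (¬_; yes; no; contradiction)
open import Relation.Nullary.Decidable using (dec⇒maybe)

-- The commutative ring of integer power series

-- Polynomials over ℤ are the series of finite support; equality is pointwise.
Series : Set
Series = ℕ → ℤ

infix  4 _≈_
infixl 6 _⊕_
infixl 7 _⊛_

-- A record rather than a bare pointwise statement, so that unification can recover `p` and `q` from
-- the type.
record _≈_ (p q : Series) : Set where
  constructor ⟨_⟩
  field at : ∀ i → p i ≡ q i
open _≈_

const : ℤ → Series
const c zero    = c
const c (suc _) = 0ℤ

shift : Series → Series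
shift p zero    = 0ℤ
shift p (suc i) = p i

tail : Series → Series
tail p i = p (suc i)

_⊕_ : Series → Series → Series
(p ⊕ q) i = p i + q i

⊖_ : Series → Series
(⊖ p) i = - p i

_⊛_ : Series → Series → Series
(p ⊛ q) zero    = p 0 * q 0
(p ⊛ q) (suc i) = p 0 * q (suc i) + (tail p ⊛ q) i

⊛-cong : ∀ {p p′ q q′} → p ≈ p′ → q ≈ q′ → p ⊛ q ≈ p′ ⊛ q′
⊛-cong e e′ = ⟨ go e e′ ⟩
  where
  go : ∀ {p p′ q q′} → p ≈ p′ → q ≈ q′ → ∀ i → (p ⊛ q) i ≡ (p′ ⊛ q′) i
  go e e′ zero    = cong₂ _*_ (at e 0) (at e′ 0)
  go e e′ (suc i) = cong₂ _+_ (cong₂ _*_ (at e 0) (at e′ (suc i)))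
                                (go ⟨ (λ j → at e (suc j)) ⟩ e′ i)

⊛-zeroˡ : ∀ {p} q → (∀ i → p i ≡ 0ℤ) → ∀ i → (p ⊛ q) i ≡ 0ℤ
⊛-zeroˡ q p≡0 zero    rewrite p≡0 0 = refl
⊛-zeroˡ q p≡0 (suc i) rewrite p≡0 0 | ⊛-zeroˡ q (λ j → p≡0 (suc j)) i = refl

const-⊛ : ∀ c p i → (const c ⊛ p) i ≡ c * p i
const-⊛ c p zero    = refl
const-⊛ c p (suc i) = trans (cong (λ z → c * p (suc i) + z) (⊛-zeroˡ p (λ _ → refl) i)) (ℤ.+-identityʳ _)

-- The definition of `_⊛_` peels coefficients off the left factor. This mirror recursion peels the
-- right one, as commutativity and `∣ˢ-cancel` require.
⊛-suc : ∀ p q i → (p ⊛ q) (suc i) ≡ (p ⊛ tail q) i + p (suc i) * q 0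
⊛-suc p q zero    = refl
⊛-suc p q (suc i) = begin
  p 0 * q (suc (suc i)) + (tail p ⊛ q) (suc i)
    ≡⟨ cong (λ z → p 0 * q (suc (suc i)) + z) (⊛-suc (tail p) q i) ⟩
  p 0 * q (suc (suc i)) + ((tail p ⊛ tail q) i + p (suc (suc i)) * q 0)
    ≡⟨ ℤ.+-assoc (p 0 * q (suc (suc i))) _ _ ⟨
  (p ⊛ tail q) (suc i) + p (suc (suc i)) * q 0 ∎
  where open ≡-Reasoning

⊛-comm : ∀ p q i → (p ⊛ q) i ≡ (q ⊛ p) i
⊛-comm p q zero    = ℤ.*-comm (p 0) (q 0)
⊛-comm p q (suc i) = begin
  p 0 * q (suc i) + (tail p ⊛ q) i
    ≡⟨ cong₂ _+_ (ℤ.*-comm (p 0) _) (⊛-comm (tail p) q i) ⟩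
  q (suc i) * p 0 + (q ⊛ tail p) i
    ≡⟨ ℤ.+-comm (q (suc i) * p 0) _ ⟩
  (q ⊛ tail p) i + q (suc i) * p 0
    ≡⟨ ⊛-suc q p i ⟨
  (q ⊛ p) (suc i) ∎
  where open ≡-Reasoning

⊛-distribʳ : ∀ r p q i → ((p ⊕ q) ⊛ r) i ≡ (p ⊛ r) i + (q ⊛ r) i
⊛-distribʳ r p q zero    = ℤ.*-distribʳ-+ (r 0) (p 0) (q 0)
⊛-distribʳ r p q (suc i)
  rewrite ⊛-distribʳ r (tail p) (tail q) i = lemma (p 0) (q 0) (r (suc i)) _ _
  where
  lemma : ∀ a b c x y → (a + b) * c + (x + y) ≡ (a * c + x) + (b * c + y)
  lemma = solve-∀

⊛-scaleˡ : ∀ c p q i → ((λ j → c * p j) ⊛ q) i ≡ c * (p ⊛ q) i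
⊛-scaleˡ c p q zero    = ℤ.*-assoc c (p 0) (q 0)
⊛-scaleˡ c p q (suc i) rewrite ⊛-scaleˡ c (tail p) q i = lemma c (p 0) (q (suc i)) _
  where
  lemma : ∀ c a b x → c * a * b + c * x ≡ c * (a * b + x)
  lemma = solve-∀

⊛-assoc : ∀ p q r i → ((p ⊛ q) ⊛ r) i ≡ (p ⊛ (q ⊛ r)) i
⊛-assoc p q r zero    = ℤ.*-assoc (p 0) (q 0) (r 0)
⊛-assoc p q r (suc i) = begin
  p 0 * q 0 * r (suc i) + (((λ j → p 0 * q (suc j)) ⊕ (tail p ⊛ q)) ⊛ r) i
    ≡⟨ cong (λ z → p 0 * q 0 * r (suc i) + z) (⊛-distribʳ r (λ j → p 0 * q (suc j)) (tail p ⊛ q) i) ⟩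
  p 0 * q 0 * r (suc i) + (((λ j → p 0 * q (suc j)) ⊛ r) i + ((tail p ⊛ q) ⊛ r) i)
    ≡⟨ cong₂ (λ x y → p 0 * q 0 * r (suc i) + (x + y))
             (⊛-scaleˡ (p 0) (tail q) r i) (⊛-assoc (tail p) q r i) ⟩
  p 0 * q 0 * r (suc i) + (p 0 * (tail q ⊛ r) i + (tail p ⊛ (q ⊛ r)) i)
    ≡⟨ lemma (p 0) (q 0) (r (suc i)) _ _ ⟩
  p 0 * (q 0 * r (suc i) + (tail q ⊛ r) i) + (tail p ⊛ (q ⊛ r)) i ∎
  where
  open ≡-Reasoning
  lemma : ∀ a b c x y → a * b * c + (a * x + y) ≡ a * (b * c + x) + y
  lemma = solve-∀

seriesRing : CommutativeRing 0ℓ 0ℓ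
seriesRing = record
  { Carrier = Series ; _≈_ = _≈_ ; _+_ = _⊕_ ; _*_ = _⊛_ ; -_ = ⊖_
  ; 0# = const 0ℤ ; 1# = const 1ℤ
  ; isCommutativeRing = record
    { isRing = record
      { +-isAbelianGroup = record
        { isGroup = record
          { isMonoid = record
            { isSemigroup = record
              { isMagma = record
                { isEquivalence = record
                  { refl  = ⟨ (λ _ → refl) ⟩
                  ; sym   = λ e → ⟨ (λ i → sym (at e i)) ⟩
                  ; trans = λ e e′ → ⟨ (λ i → trans (at e i) (at e′ i)) ⟩
                  }
                ; ∙-cong = λ e e′ → ⟨ (λ i → cong₂ _+_ (at e i) (at e′ i)) ⟩
                }
              ; assoc = λ p q r → ⟨ (λ i → ℤ.+-assoc (p i) (q i) (r i)) ⟩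
              }
            ; identity = (λ p → ⟨ (λ i → trans (cong (λ z → z + p i) (zero-at i)) (ℤ.+-identityˡ (p i))) ⟩)
                       , (λ p → ⟨ (λ i → trans (cong (λ z → p i + z) (zero-at i)) (ℤ.+-identityʳ (p i))) ⟩)
            }
          ; inverse = (λ p → ⟨ (λ i → trans (ℤ.+-inverseˡ (p i)) (sym (zero-at i))) ⟩)
                    , (λ p → ⟨ (λ i → trans (ℤ.+-inverseʳ (p i)) (sym (zero-at i))) ⟩)
          ; ⁻¹-cong = λ e → ⟨ (λ i → cong -_ (at e i)) ⟩
          }
        ; comm = λ p q → ⟨ (λ i → ℤ.+-comm (p i) (q i)) ⟩
        }
      ; *-cong = ⊛-cong
      ; *-assoc = λ p q r → ⟨ ⊛-assoc p q r ⟩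
      ; *-identity = (λ p → ⟨ one-⊛ p ⟩)
                   , (λ p → ⟨ (λ i → trans (⊛-comm p (const 1ℤ) i) (one-⊛ p i)) ⟩)
      ; distrib = (λ p q r → ⟨ (λ i → trans (⊛-comm p (q ⊕ r) i) (trans (⊛-distribʳ p q r i)
                                 (cong₂ _+_ (⊛-comm q p i) (⊛-comm r p i)))) ⟩)
                , (λ r p q → ⟨ ⊛-distribʳ r p q ⟩)
      }
    ; *-comm = λ p q → ⟨ ⊛-comm p q ⟩
    }
  }
  where
  zero-at : ∀ i → const 0ℤ i ≡ 0ℤ
  zero-at zero    = refl
  zero-at (suc i) = refl
  one-⊛ : ∀ p i → (const 1ℤ ⊛ p) i ≡ p i
  one-⊛ p i = trans (const-⊛ 1ℤ p i) (ℤ.*-identityˡ (p i))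

module R = CommutativeRing seriesRing

-- Equality of series is not decidable, so the solver takes its coefficients from ℤ, embedded as
-- constants.
const-morphism : CommutativeRing.rawRing ℤ.+-*-commutativeRing
  ACR.-Raw-AlmostCommutative⟶ ACR.fromCommutativeRing seriesRing
const-morphism = record
  { ⟦_⟧    = const
  ; +-homo = λ a b → ⟨ (λ { zero → refl ; (suc _) → refl }) ⟩
  ; *-homo = λ a b → ⟨ (λ { zero → refl ; (suc i) → sym (trans (const-⊛ a (const b) (suc i)) (ℤ.*-zeroʳ a)) }) ⟩
  ; -‿homo = λ a → ⟨ (λ { zero → refl ; (suc _) → refl }) ⟩
  ; 0-homo = R.refl
  ; 1-homo = R.refl
  }

const≟ : ∀ a b → Maybe.Maybe (const a ≈ const b)
const≟ a b = Maybe.map (λ a≡b → R.reflexive (cong const a≡b)) (dec⇒maybe (a ℤ.≟ b))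

open import Algebra.Solver.Ring (CommutativeRing.rawRing ℤ.+-*-commutativeRing)
  (ACR.fromCommutativeRing seriesRing) const-morphism const≟
  using (con; _:+_; _:*_; :-_; _:=_) renaming (solve to solveˢ)

infixl 6 _⊝_
_⊝_ : Series → Series → Series
p ⊝ q = p ⊕ ⊖ q

-- Brahmagupta's identity: the norm of (a + b√x)(c + d√x) is the product of the norms.
norm-identity : ∀ x a b c d →
  (a ⊛ a ⊝ x ⊛ (b ⊛ b)) ⊛ (c ⊛ c ⊝ x ⊛ (d ⊛ d))
    ≈ (a ⊛ c ⊕ x ⊛ (b ⊛ d)) ⊛ (a ⊛ c ⊕ x ⊛ (b ⊛ d)) ⊝ x ⊛ ((a ⊛ d ⊕ b ⊛ c) ⊛ (a ⊛ d ⊕ b ⊛ c))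
norm-identity = solveˢ 5 (λ x a b c d →
  (a :* a :+ :- (x :* (b :* b))) :* (c :* c :+ :- (x :* (d :* d)))
    := (a :* c :+ x :* (b :* d)) :* (a :* c :+ x :* (b :* d))
       :+ :- (x :* ((a :* d :+ b :* c) :* (a :* d :+ b :* c)))) R.refl

-- Polynomials and Gauss's lemma

Bounded : ℕ → Series → Set
Bounded n p = ∀ i → n ≤ i → p i ≡ 0ℤ

Finite : Series → Set
Finite p = ∃ λ n → Bounded n p

Constant : Series → Set
Constant p = ∀ i → p (suc i) ≡ 0ℤ

bounded-mono : ∀ {m n p} → m ≤ n → Bounded m p → Bounded n p
bounded-mono m≤n b i n≤i = b i (ℕ.≤-trans m≤n n≤i)

bounded-⊕ : ∀ {n p q} → Bounded n p → Bounded n q → Bounded n (p ⊕ q)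
bounded-⊕ b b′ i n≤i rewrite b i n≤i | b′ i n≤i = refl

bounded-⊖ : ∀ {n p} → Bounded n p → Bounded n (⊖ p)
bounded-⊖ b i n≤i rewrite b i n≤i = refl

bounded-shift : ∀ {n p} → Bounded n p → Bounded (suc n) (shift p)
bounded-shift b (suc i) (s≤s n≤i) = b i n≤i

bounded-const : ∀ c → Bounded 1 (const c)
bounded-const c (suc i) _ = refl

bounded-⊛ : ∀ {m n p q} → Bounded m p → Bounded n q → Bounded (m ℕ.+ n) (p ⊛ q)
bounded-⊛ {zero}          b b′ i       _ = ⊛-zeroˡ _ (λ j → b j z≤n) i
bounded-⊛ {suc m} {n} {p} b b′ (suc i) (s≤s m+n≤i)
  rewrite b′ (suc i) (ℕ.≤-trans (ℕ.m≤n+m n m) (ℕ.m≤n⇒m≤1+n m+n≤i))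
        | bounded-⊛ {m} (λ j m≤j → b (suc j) (s≤s m≤j)) b′ i m+n≤i
        | ℤ.*-zeroʳ (p 0) = refl

finite-⊕ : ∀ {p q} → Finite p → Finite q → Finite (p ⊕ q)
finite-⊕ (m , b) (n , b′) =
  m ℕ.⊔ n , bounded-⊕ (bounded-mono (ℕ.m≤m⊔n m n) b) (bounded-mono (ℕ.m≤n⊔m m n) b′)

finite-⊖ : ∀ {p} → Finite p → Finite (⊖ p)
finite-⊖ (n , b) = n , bounded-⊖ b

finite-⊛ : ∀ {p q} → Finite p → Finite q → Finite (p ⊛ q)
finite-⊛ (m , b) (n , b′) = m ℕ.+ n , bounded-⊛ b b′

finite-shift : ∀ {p} → Finite p → Finite (shift p)
finite-shift (n , b) = suc n , bounded-shift b

finite-const : ∀ c → Finite (const c)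
finite-const c = 1 , bounded-const c

top-coefficient : ∀ {m n p q} → Bounded (suc m) p → Bounded (suc n) q →
                  (p ⊛ q) (m ℕ.+ n) ≡ p m * q n
top-coefficient {zero}  {zero}        b b′ = refl
top-coefficient {zero}  {suc n} {p} {q} b b′ =
  trans (cong (λ z → p 0 * q (suc n) + z) (⊛-zeroˡ q (λ j → b (suc j) (s≤s z≤n)) n)) (ℤ.+-identityʳ _)
top-coefficient {suc m} {n} {p} {q} b b′
  rewrite b′ (suc (m ℕ.+ n)) (s≤s (ℕ.m≤n+m n m)) | ℤ.*-zeroʳ (p 0)
        | top-coefficient {m} {n} {tail p} {q} (λ j m≤j → b (suc j) (s≤s m≤j)) b′ = ℤ.+-identityˡ _

exact-degree : ∀ n p → Bounded n p →
  (∀ i → p i ≡ 0ℤ) ⊎ ∃ λ e → e < n × p e ≢ 0ℤ × Bounded (suc e) p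
exact-degree zero    p b = inj₁ (λ i → b i z≤n)
exact-degree (suc n) p b with p n ℤ.≟ 0ℤ
... | no p≢0  = inj₂ (n , ℕ.≤-refl , p≢0 , b)
... | yes p≡0 with exact-degree n p b′
  where
  b′ : Bounded n p
  b′ i n≤i with ℕ.m≤n⇒m<n∨m≡n n≤i
  ... | inj₁ n<i  = b i n<i
  ... | inj₂ refl = p≡0
... | inj₁ z                = inj₁ z
... | inj₂ (e , e<n , rest) = inj₂ (e , ℕ.m≤n⇒m≤1+n e<n , rest)

infix 4 _∣ˢ_
_∣ˢ_ : ℤ → Series → Set
c ∣ˢ p = ∀ i → c ∣ₛ p i

∣ˢ-quotient : ∀ {c p} → c ∣ˢ p → ∃ λ q → p ≈ const c ⊛ q
∣ˢ-quotient {c} {p} d = (λ i → _∣ₛ_.quotient (d i)) , ⟨ (λ i →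
  trans (_∣ₛ_.equality (d i)) (trans (ℤ.*-comm _ c) (sym (const-⊛ c _ i)))) ⟩

∣ˢ-const-⊛ : ∀ c p → c ∣ˢ const c ⊛ p
∣ˢ-const-⊛ c p i = divides (p i) (trans (const-⊛ c p i) (ℤ.*-comm c (p i)))

const-⊛-cancel : ∀ {c p q} → c ≢ 0ℤ → const c ⊛ p ≈ const c ⊛ q → p ≈ q
const-⊛-cancel {c} {p} {q} c≢0 e = ⟨ (λ i → ℤ.*-cancelˡ-≡ c (p i) (q i) {{ℤ.≢-nonZero c≢0}}
  (trans (sym (const-⊛ c p i)) (trans (at e i) (const-⊛ c q i)))) ⟩

-- Works upwards from the constant term: once c divides `q 0`, removing the contribution of `q 0`
-- from the product leaves `p ⊛ tail q`, to which the same argument applies. Cancellability of `p 0`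
-- is a hypothesis so as to cover both `p 0` = 1 with arbitrary c, even c = 0, and a prime c not
-- dividing `p 0`.
∣ˢ-cancel : ∀ {c p} q → (∀ x → c ∣ₛ p 0 * x → c ∣ₛ x) → c ∣ˢ p ⊛ q → c ∣ˢ q
∣ˢ-cancel {c} {p} q cancel d zero    = cancel _ (d 0)
∣ˢ-cancel {c} {p} q cancel d (suc i) = ∣ˢ-cancel (tail q) cancel d′ i
  where
  d′ : c ∣ˢ p ⊛ tail q
  d′ j = ∣m+n∣n⇒∣m (subst (c ∣ₛ_) (⊛-suc p q j) (d (suc j)))
                   (∣n⇒∣m*n (p (suc j)) (cancel _ (d 0)))

∣ˢ-cancel-monic : ∀ {c p} q → p 0 ≡ 1ℤ → c ∣ˢ p ⊛ q → c ∣ˢ q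
∣ˢ-cancel-monic q p0≡1 = ∣ˢ-cancel q λ x →
  subst (_ ∣ₛ_) (trans (cong (_* x) p0≡1) (ℤ.*-identityˡ x))

euclid : ∀ {ℓ} → Prime ℓ → ∀ a b → + ℓ ∣ₛ a * b → + ℓ ∣ₛ a ⊎ + ℓ ∣ₛ b
euclid ℓ-prime a b d = Sum.map ∣ᵤ⇒∣ ∣ᵤ⇒∣
  (euclidsLemma ℤ.∣ a ∣ ℤ.∣ b ∣ ℓ-prime (subst (_ ℕ.∣_) (ℤ.abs-* a b) (∣⇒∣ᵤ d)))

-- The core of Gauss's lemma. Low coefficients of p divisible by ℓ are dropped, which does not
-- affect the hypothesis; at the first one that is not, `∣ˢ-cancel` gives the claim for q. The bound
-- on p makes the search end.
prime-∣ˢ-⊛ : ∀ {ℓ} → Prime ℓ → ∀ {n} p q → Bounded n p → + ℓ ∣ˢ p ⊛ q → + ℓ ∣ˢ p ⊎ + ℓ ∣ˢ q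
prime-∣ˢ-⊛ ℓ-prime {zero} p q b d = inj₁ (λ i → subst (_ ∣ₛ_) (sym (b i z≤n)) (divides 0ℤ refl))
prime-∣ˢ-⊛ {ℓ} ℓ-prime {suc n} p q b d with + ℓ ∣? p 0
... | no ℓ∤p0  = inj₂ (∣ˢ-cancel q (λ x ℓ∣p0x → Sum.[ (λ ℓ∣p0 → contradiction ℓ∣p0 ℓ∤p0) , (λ z → z) ]
                                                   (euclid ℓ-prime (p 0) x ℓ∣p0x)) d)
... | yes ℓ∣p0 = Sum.map₁ (λ { ℓ∣tail zero → ℓ∣p0 ; ℓ∣tail (suc i) → ℓ∣tail i })
  (prime-∣ˢ-⊛ ℓ-prime {n} (tail p) q (λ i n≤i → b (suc i) (s≤s n≤i))
     (λ i → ∣m+n∣m⇒∣n (d (suc i)) (∣m⇒∣m*n (q (suc i)) ℓ∣p0)))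

-- Stands for "proportional": it records what later survives of a rescaling, since bounds and
-- constancy depend only on which coefficients vanish, and it spares carrying the scale factors
-- along.
SameZeros : Series → Series → Set
SameZeros p q = ∀ i → (p i ≡ 0ℤ → q i ≡ 0ℤ) × (q i ≡ 0ℤ → p i ≡ 0ℤ)

sameZeros-const-⊛ : ∀ {c p} q → c ≢ 0ℤ → p ≈ const c ⊛ q → SameZeros p q
sameZeros-const-⊛ {c} {p} q c≢0 e i =
    (λ p≡0 → Sum.[ (λ c≡0 → contradiction c≡0 c≢0) , (λ z → z) ]
               (ℤ.i*j≡0⇒i≡0∨j≡0 c (trans (sym p≡cq) p≡0)))
  , (λ q≡0 → trans p≡cq (trans (cong (c *_) q≡0) (ℤ.*-zeroʳ c)))
  where
  p≡cq : p i ≡ c * q i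
  p≡cq = trans (at e i) (const-⊛ c q i)

sameZeros-refl : ∀ {p} → SameZeros p p
sameZeros-refl i = (λ z → z) , (λ z → z)

sameZeros-trans : ∀ {p q r} → SameZeros p q → SameZeros q r → SameZeros p r
sameZeros-trans s t i = (λ z → proj₁ (t i) (proj₁ (s i) z)) , (λ z → proj₂ (s i) (proj₂ (t i) z))

Primitivised : Series → Series → Series → Set
Primitivised f s u = ∃ λ s′ → ∃ λ u′ → f ≈ s′ ⊛ u′ × SameZeros s s′ × SameZeros u u′

const-* : ∀ a b → const (a * b) ≈ const a ⊛ const b
const-* = ACR._-Raw-AlmostCommutative⟶_.*-homo const-morphism

⊛-swap : ∀ p q r → p ⊛ (q ⊛ r) ≈ q ⊛ (p ⊛ r)
⊛-swap = solveˢ 3 (λ p q r → p :* (q :* r) := q :* (p :* r)) R.refl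

prime≢0 : ∀ {ℓ} → Prime ℓ → + ℓ ≢ 0ℤ
prime≢0 ℓ-prime eq = ℕ.≢-nonZero⁻¹ _ {{prime⇒nonZero ℓ-prime}} (ℤ.+-injective eq)

-- Each prime of the multiplier divides one of the two factors entirely and is divided out there.
gauss-primes : ∀ ps → All Prime ps → ∀ {f n} s u → Bounded n s →
               const (+ product ps) ⊛ f ≈ s ⊛ u → Primitivised f s u
gauss-primes [] [] s u b e = s , u , R.trans (R.sym (R.*-identityˡ _)) e , sameZeros-refl , sameZeros-refl
gauss-primes (ℓ ∷ ps) (ℓ-prime ∷ ps-prime) {f} s u b e = peel (prime-∣ˢ-⊛ ℓ-prime s u b ℓ∣su)
  where
  ℓ≢0 = prime≢0 ℓ-prime

  ℓ∣su : + ℓ ∣ˢ s ⊛ u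
  ℓ∣su i = subst (+ ℓ ∣ₛ_) (trans (sym (const-⊛ _ f i)) (at e i))
             (∣m⇒∣m*n {m = + product (ℓ ∷ ps)} (f i) (∣ᵤ⇒∣ (ℕ.m∣m*n (product ps))))

  e′ : const (+ ℓ) ⊛ (const (+ product ps) ⊛ f) ≈ s ⊛ u
  e′ = R.trans (R.sym (R.*-assoc _ _ f))
         (R.trans (R.*-congʳ (R.trans (R.sym (const-* (+ ℓ) (+ product ps)))
                                      (R.reflexive (cong const (sym (ℤ.pos-* ℓ (product ps)))))))
           e)

  peel : + ℓ ∣ˢ s ⊎ + ℓ ∣ˢ u → Primitivised f s u
  peel (inj₁ ℓ∣s) =
    let s₁ , s≈ = ∣ˢ-quotient ℓ∣s
        zs = sameZeros-const-⊛ s₁ ℓ≢0 s≈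
        s′ , u′ , f≈ , z , z′ = gauss-primes ps ps-prime s₁ u (λ i n≤i → proj₁ (zs i) (b i n≤i))
          (const-⊛-cancel ℓ≢0 (R.trans e′ (R.trans (R.*-congʳ s≈) (R.*-assoc _ s₁ u))))
    in s′ , u′ , f≈ , sameZeros-trans zs z , z′
  peel (inj₂ ℓ∣u) =
    let u₁ , u≈ = ∣ˢ-quotient ℓ∣u
        zs = sameZeros-const-⊛ u₁ ℓ≢0 u≈
        s′ , u′ , f≈ , z , z′ = gauss-primes ps ps-prime s u₁ b
          (const-⊛-cancel ℓ≢0 (R.trans e′ (R.trans (R.*-congˡ u≈) (⊛-swap s (const (+ ℓ)) u₁))))
    in s′ , u′ , f≈ , z , sameZeros-trans zs z′

gauss : ∀ {c f} s u → c ≢ 0ℤ → Finite s → const c ⊛ f ≈ s ⊛ u → Primitivised f s u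
gauss {+ 0} s u c≢0 _ _ = contradiction refl c≢0
gauss {+ suc c} {f} s u c≢0 (_ , b) e =
  gauss-primes factors factorsPrime s u b
    (R.trans (R.*-congʳ (R.reflexive (cong (λ z → const (+ z)) (sym isFactorisation)))) e)
  where open PrimeFactorisation (factorise (suc c))
-- The sign of the multiplier is moved into s.
gauss {ℤ.-[1+ c ]} {f} s u c≢0 (n , b) e =
  let s′ , u′ , f≈ , z , z′ = gauss (⊖ s) u (λ ()) (n , bounded-⊖ b)
        (R.trans (⊖-⊛ (+ suc c) f) (R.trans (R.-‿cong e) (⊖-distrib s u)))
  in s′ , u′ , f≈ , sameZeros-trans sameZeros-⊖ z , z′
  where
  ⊖-⊛ : ∀ c f → const c ⊛ f ≈ ⊖ (const (- c) ⊛ f)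
  ⊖-⊛ c f = ⟨ (λ i → trans (const-⊛ c f i) (trans (lemma c (f i)) (cong (λ x → - x) (sym (const-⊛ (- c) f i))))) ⟩
    where
    lemma : ∀ a b → a * b ≡ - (- a * b)
    lemma = solve-∀
  ⊖-distrib : ∀ s u → ⊖ (s ⊛ u) ≈ ⊖ s ⊛ u
  ⊖-distrib = solveˢ 2 (λ s u → :- (s :* u) := (:- s) :* u) R.refl
  sameZeros-⊖ : ∀ {p} → SameZeros p (⊖ p)
  sameZeros-⊖ {p} i = cong (λ x → - x) , λ z → ℤ.neg-injective z

-- Irreducible polynomials are prime

X : Series
X = shift (const 1ℤ)

shift-⊛ : ∀ p → shift p ≈ X ⊛ p
shift-⊛ p = ⟨ (λ { zero    → refl
                 ; (suc i) → sym (trans (ℤ.+-identityˡ _) (at (R.*-identityˡ p) i)) }) ⟩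

head-tail : ∀ p → p ≈ const (p 0) ⊕ X ⊛ tail p
head-tail p = ⟨ (λ { zero → sym (ℤ.+-identityʳ (p 0))
                   ; (suc i) → sym (trans (ℤ.+-identityˡ _) (sym (at (shift-⊛ (tail p)) (suc i)))) }) ⟩

IrreducibleSeries : Series → Set
IrreducibleSeries f = ∀ p q → Finite p → Finite q → f ≈ p ⊛ q → Constant p ⊎ Constant q

infix 4 _∣ᶠ_
-- Finiteness of the quotient is essential: a series with constant term 1 is invertible in ℤ[[x]]
-- and would otherwise divide everything.
_∣ᶠ_ : Series → Series → Set
f ∣ᶠ p = ∃ λ q → Finite q × p ≈ f ⊛ q

scale-head-tail : ∀ l c h x q → l ⊛ c ⊛ (h ⊕ x ⊛ q) ≈ l ⊛ (c ⊛ h ⊕ x ⊛ (c ⊛ q))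
scale-head-tail = solveˢ 5 (λ l c h x q →
  l :* c :* (h :+ x :* q) := l :* (c :* h :+ x :* (c :* q))) R.refl

division-step : ∀ l k x s u r t →
  l ⊛ (k ⊕ x ⊛ (s ⊛ u ⊕ r)) ≈ (l ⊛ (x ⊛ s) ⊕ t) ⊛ u ⊕ (l ⊛ (k ⊕ x ⊛ r) ⊝ t ⊛ u)
division-step = solveˢ 7 (λ l k x s u r t →
  l :* (k :+ x :* (s :* u :+ r)) := (l :* (x :* s) :+ t) :* u :+ (l :* (k :+ x :* r) :+ :- (t :* u))) R.refl

remainder-⊛ : ∀ r q s u → r ⊛ q ≈ (s ⊛ u ⊕ r) ⊛ q ⊝ s ⊛ (u ⊛ q)
remainder-⊛ = solveˢ 4 (λ r q s u → r :* q := (s :* u :+ r) :* q :+ :- (s :* (u :* q))) R.refl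

factor-left : ∀ c f q s h → (c ⊛ f) ⊛ q ⊝ s ⊛ (f ⊛ h) ≈ f ⊛ (c ⊛ q ⊝ s ⊛ h)
factor-left = solveˢ 5 (λ c f q s h → (c :* f) :* q :+ :- (s :* (f :* h)) := f :* (c :* q :+ :- (s :* h))) R.refl

zero-division : ∀ p u → const 1ℤ ⊛ p ≈ const 0ℤ ⊛ u ⊕ p
zero-division = solveˢ 2 (λ p u → con 1ℤ :* p := con 0ℤ :* u :+ p) R.refl

module _ {u : Series} {e : ℕ} (lead≢0 : u e ≢ 0ℤ) (u-bounded : Bounded (suc e) u) where

  -- The leading coefficient of u need not be a unit, hence the multiplier c. The recursion is
  -- Horner's: after dividing `tail p`, the candidate remainder `r₁` = c p₀ + x r has degree at most
  -- e, and `const (u e) ⊛ r₁ ⊝ const t ⊛ u` with t = `r₁ e` cancels its coefficient at e.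
  pseudo-divide : ∀ n p → Bounded n p →
    ∃ λ c → ∃ λ s → ∃ λ r → c ≢ 0ℤ × Finite s × Bounded e r × const c ⊛ p ≈ s ⊛ u ⊕ r
  pseudo-divide zero p b =
    1ℤ , const 0ℤ , p , (λ ()) , finite-const 0ℤ , bounded-mono z≤n b ,
    zero-division p u
  pseudo-divide (suc n) p b with pseudo-divide n (tail p) (λ i n≤i → b (suc i) (s≤s n≤i))
  ... | c , s , r , c≢0 , s-finite , r-bounded , eq =
    u e * c , const (u e) ⊛ shift s ⊕ const t , const (u e) ⊛ r₁ ⊝ const t ⊛ u
    , (λ z → Sum.[ lead≢0 , c≢0 ] (ℤ.i*j≡0⇒i≡0∨j≡0 (u e) z))
    , finite-⊕ (finite-⊛ (finite-const (u e)) (finite-shift s-finite)) (finite-const t)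
    , r′-bounded
    , eq′
    where
    r₁ = const (c * p 0) ⊕ shift r
    t  = r₁ e

    r₁-bounded : Bounded (suc e) r₁
    r₁-bounded = bounded-⊕ (bounded-mono (s≤s z≤n) (bounded-const _)) (bounded-shift r-bounded)

    r′-bounded : Bounded e (const (u e) ⊛ r₁ ⊝ const t ⊛ u)
    r′-bounded i e≤i = trans (cong₂ _-_ (const-⊛ (u e) r₁ i) (const-⊛ t u i)) (cancel (ℕ.m≤n⇒m<n∨m≡n e≤i))
      where
      cancel : e < i ⊎ e ≡ i → u e * r₁ i - t * u i ≡ 0ℤ
      cancel (inj₁ e<i)  = cong₂ _-_ (trans (cong (u e *_) (r₁-bounded i e<i)) (ℤ.*-zeroʳ (u e)))
                                     (trans (cong (t *_) (u-bounded i e<i)) (ℤ.*-zeroʳ t))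
      cancel (inj₂ refl) = trans (cong (λ z → z - t * u e) (ℤ.*-comm (u e) t)) (ℤ.+-inverseʳ (t * u e))

    open import Relation.Binary.Reasoning.Setoid R.setoid

    eq′ : const (u e * c) ⊛ p ≈ (const (u e) ⊛ shift s ⊕ const t) ⊛ u ⊕ (const (u e) ⊛ r₁ ⊝ const t ⊛ u)
    eq′ = begin
      const (u e * c) ⊛ p
        ≈⟨ R.*-cong (const-* (u e) c) (head-tail p) ⟩
      const (u e) ⊛ const c ⊛ (const (p 0) ⊕ X ⊛ tail p)
        ≈⟨ scale-head-tail (const (u e)) (const c) (const (p 0)) X (tail p) ⟩
      const (u e) ⊛ (const c ⊛ const (p 0) ⊕ X ⊛ (const c ⊛ tail p))
        ≈⟨ R.*-congˡ (R.+-cong (const-* c (p 0)) (R.*-congˡ (R.sym eq))) ⟨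
      const (u e) ⊛ (const (c * p 0) ⊕ X ⊛ (s ⊛ u ⊕ r))
        ≈⟨ division-step (const (u e)) (const (c * p 0)) X s u r (const t) ⟩
      (const (u e) ⊛ (X ⊛ s) ⊕ const t) ⊛ u ⊕ (const (u e) ⊛ (const (c * p 0) ⊕ X ⊛ r) ⊝ const t ⊛ u)
        ≈⟨ R.+-cong (R.*-congʳ (R.+-congʳ (R.*-congˡ (shift-⊛ s))))
                    (R.+-congʳ (R.*-congˡ (R.+-congˡ {const (c * p 0)} (shift-⊛ r)))) ⟨
      (const (u e) ⊛ shift s ⊕ const t) ⊛ u ⊕ (const (u e) ⊛ r₁ ⊝ const t ⊛ u) ∎

constant-≈ : ∀ {p} → Constant p → p ≈ const (p 0)
constant-≈ c = ⟨ (λ { zero → refl ; (suc i) → c i }) ⟩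

sameZeros-constant : ∀ {p q} → SameZeros p q → Constant q → Constant p
sameZeros-constant z c i = proj₂ (z (suc i)) (c i)

finite-const-⊛⁻ : ∀ {c p} q → c ≢ 0ℤ → p ≈ const c ⊛ q → Finite p → Finite q
finite-const-⊛⁻ q c≢0 e (n , b) = n , λ i n≤i → proj₁ (sameZeros-const-⊛ q c≢0 e i) (b i n≤i)

-- If c q = f h with f(0) = 1, then c divides h coefficientwise. This removes the multipliers that
-- pseudo-division introduces.
∣ᶠ-const-⊛⁻ : ∀ {f c} q → f 0 ≡ 1ℤ → c ≢ 0ℤ → f ∣ᶠ const c ⊛ q → f ∣ᶠ q
∣ᶠ-const-⊛⁻ {f} {c} q f0≡1 c≢0 (h , h-finite , e) =
  let h′ , h≈ = ∣ˢ-quotient (∣ˢ-cancel-monic h f0≡1 (λ i → subst (c ∣ₛ_) (at e i) (∣ˢ-const-⊛ c q i)))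
  in h′ , finite-const-⊛⁻ h′ c≢0 h≈ h-finite
   , const-⊛-cancel c≢0 (R.trans e (R.trans (R.*-congˡ h≈) (⊛-swap f (const c) h′)))

bounded-zero : ∀ {p} → (∀ i → p i ≡ 0ℤ) → p ≈ const 0ℤ
bounded-zero z = ⟨ (λ { zero → z 0 ; (suc i) → z (suc i) }) ⟩

module _ {f : Series} {d : ℕ} (f-irreducible : IrreducibleSeries f) (f0≡1 : f 0 ≡ 1ℤ)
         (fd≢0 : f d ≢ 0ℤ) (f-bounded : Bounded (suc d) f) {q : Series} (q-finite : Finite q) where

  open import Relation.Binary.Reasoning.Setoid R.setoid

  constant-cancel : ∀ {u} → Constant u → u 0 ≢ 0ℤ → f ∣ᶠ u ⊛ q → f ∣ᶠ q
  constant-cancel u-constant u0≢0 (h , h-finite , uq≈fh) = ∣ᶠ-const-⊛⁻ q f0≡1 u0≢0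
    (h , h-finite , R.trans (R.*-congʳ (R.sym (constant-≈ u-constant))) uq≈fh)

  lead-constant : ∀ {u} e → Constant u → u e ≢ 0ℤ → u 0 ≢ 0ℤ
  lead-constant zero    c u0≢0 = u0≢0
  lead-constant (suc e) c ue≢0 = contradiction (c e) ue≢0

  -- By `gauss`, f is a product of rescaled copies of s and u, so one of them is constant. It cannot
  -- be s, for f would then have no more than the degree of u, which is below d.
  short-divisor-constant : ∀ {c} s u e → Bounded (suc e) u → e < d → c ≢ 0ℤ → Finite s →
                           const c ⊛ f ≈ s ⊛ u → Constant u
  short-divisor-constant s u e u-bounded e<d c≢0 (m , s-bounded) eq = conclude (gauss s u c≢0 (m , s-bounded) eq)
    where
    conclude : Primitivised f s u → Constant u
    conclude (s′ , u′ , f≈s′u′ , zs , zu) = Sum.[ absurd , sameZeros-constant zu ]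
      (f-irreducible s′ u′ (m , λ i m≤i → proj₁ (zs i) (s-bounded i m≤i))
                           (suc e , λ i e<i → proj₁ (zu i) (u-bounded i e<i)) f≈s′u′)
      where
      absurd : Constant s′ → Constant u
      absurd s′-constant = contradiction
        (trans (at f≈s′u′ d) (trans (at (⊛-cong (constant-≈ s′-constant) (R.refl {u′})) d)
          (trans (const-⊛ (s′ 0) u′ d)
            (trans (cong (s′ 0 *_) (proj₁ (zu d) (u-bounded d e<d))) (ℤ.*-zeroʳ (s′ 0))))))
        fd≢0

  -- Euclid's algorithm on f and u: every remainder r again has f dividing r q.
  irreducible-cancel : ∀ n u e → e < n → u e ≢ 0ℤ → Bounded (suc e) u → e < d → f ∣ᶠ u ⊛ q → f ∣ᶠ q
  irreducible-cancel (suc n) u e (s≤s e≤n) lead≢0 u-bounded e<d (h , h-finite , uq≈fh) =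
    divide (pseudo-divide lead≢0 u-bounded (suc d) f f-bounded)
    where
    divide : (∃ λ c → ∃ λ s → ∃ λ r →
                c ≢ 0ℤ × Finite s × Bounded e r × const c ⊛ f ≈ s ⊛ u ⊕ r) → f ∣ᶠ q
    divide (c , s , r , c≢0 , s-finite , r-bounded , eq) = continue (exact-degree e r r-bounded)
      where
      continue : (∀ i → r i ≡ 0ℤ) ⊎ (∃ λ e′ → e′ < e × r e′ ≢ 0ℤ × Bounded (suc e′) r) → f ∣ᶠ q
      -- Here u divides a nonzero multiple of f and has smaller degree, so it is a constant and
      -- cancels.
      continue (inj₁ r≡0) =
        constant-cancel {u} u-constant (lead-constant {u} e u-constant lead≢0) (h , h-finite , uq≈fh)
        where
        u-constant : Constant u
        u-constant = short-divisor-constant s u e u-bounded e<d c≢0 s-finite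
          (R.trans eq (R.trans (R.+-congˡ {s ⊛ u} (bounded-zero r≡0)) (R.+-identityʳ (s ⊛ u))))
      continue (inj₂ (e′ , e′<e , lead′≢0 , r-bounded′)) =
        irreducible-cancel n r e′ (ℕ.≤-trans e′<e e≤n) lead′≢0 r-bounded′ (ℕ.<-trans e′<e e<d)
          ( const c ⊛ q ⊝ s ⊛ h
          , finite-⊕ (finite-⊛ (finite-const c) q-finite) (finite-⊖ (finite-⊛ s-finite h-finite))
          , rq≈)
        where
        rq≈ : r ⊛ q ≈ f ⊛ (const c ⊛ q ⊝ s ⊛ h)
        rq≈ = begin
          r ⊛ q                               ≈⟨ remainder-⊛ r q s u ⟩
          (s ⊛ u ⊕ r) ⊛ q ⊝ s ⊛ (u ⊛ q)       ≈⟨ R.+-cong (R.*-congʳ (R.sym eq)) (R.-‿cong (R.*-congˡ uq≈fh)) ⟩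
          (const c ⊛ f) ⊛ q ⊝ s ⊛ (f ⊛ h)     ≈⟨ factor-left (const c) f q s h ⟩
          f ⊛ (const c ⊛ q ⊝ s ⊛ h)           ∎

  -- Reduction of p modulo f either leaves no remainder, so that f divides p, or a remainder r of
  -- smaller degree with f dividing r q, from which `irreducible-cancel` removes r.
  irreducible⇒prime : ∀ p → Finite p → f ∣ᶠ p ⊛ q → f ∣ᶠ p ⊎ f ∣ᶠ q
  irreducible⇒prime p (n , p-bounded) (h , h-finite , pq≈fh) =
    divide (pseudo-divide fd≢0 f-bounded n p p-bounded)
    where
    divide : (∃ λ c → ∃ λ s → ∃ λ r →
                c ≢ 0ℤ × Finite s × Bounded d r × const c ⊛ p ≈ s ⊛ f ⊕ r) → f ∣ᶠ p ⊎ f ∣ᶠ q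
    divide (c , s , r , c≢0 , s-finite , r-bounded , eq) = continue (exact-degree d r r-bounded)
      where
      continue : (∀ i → r i ≡ 0ℤ) ⊎ (∃ λ e → e < d × r e ≢ 0ℤ × Bounded (suc e) r) → f ∣ᶠ p ⊎ f ∣ᶠ q
      continue (inj₁ r≡0) = inj₁ (∣ᶠ-const-⊛⁻ p f0≡1 c≢0 (s , s-finite ,
        R.trans eq (R.trans (R.+-congˡ {s ⊛ f} (bounded-zero r≡0)) (R.trans (R.+-identityʳ (s ⊛ f)) (R.*-comm s f)))))
      continue (inj₂ (e , e<d , lead≢0 , r-bounded′)) =
        inj₂ (irreducible-cancel (suc e) r e ℕ.≤-refl lead≢0 r-bounded′ e<d
          ( const c ⊛ h ⊝ s ⊛ q
          , finite-⊕ (finite-⊛ (finite-const c) h-finite) (finite-⊖ (finite-⊛ s-finite q-finite))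
          , rq≈))
        where
        rq≈ : r ⊛ q ≈ f ⊛ (const c ⊛ h ⊝ s ⊛ q)
        rq≈ = begin
          r ⊛ q
            ≈⟨ remainder-⊛ r q s f ⟩
          (s ⊛ f ⊕ r) ⊛ q ⊝ s ⊛ (f ⊛ q)
            ≈⟨ R.+-congʳ (R.*-congʳ (R.sym eq)) ⟩
          (const c ⊛ p) ⊛ q ⊝ s ⊛ (f ⊛ q)
            ≈⟨ R.+-congʳ (R.trans (R.*-assoc (const c) p q) (R.trans (R.*-congˡ pq≈fh)
                 (R.sym (R.*-assoc (const c) f h)))) ⟩
          (const c ⊛ f) ⊛ h ⊝ s ⊛ (f ⊛ q)
            ≈⟨ factor-left (const c) f h s q ⟩
          f ⊛ (const c ⊛ h ⊝ s ⊛ q) ∎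

-- The norm

double : ℕ → ℕ
double zero    = zero
double (suc n) = suc (suc (double n))

double≡+ : ∀ n → double n ≡ n ℕ.+ n
double≡+ zero    = refl
double≡+ (suc n) = cong suc (trans (cong suc (double≡+ n)) (sym (ℕ.+-suc n n)))

data Parity : ℕ → Set where
  even : ∀ j → Parity (double j)
  odd  : ∀ j → Parity (suc (double j))

parity : ∀ n → Parity n
parity zero = even zero
parity (suc n) with parity n
... | even j = odd j
... | odd j  = even (suc j)

evens odds : Series → Series
evens p i = p (double i)
odds  p i = p (suc (double i))

mutual
  -- Mutual with `odds-⊛` because dropping the constant term swaps the parities: `evens (tail p)` is
  -- `odds p`, and `odds (tail p)` is `tail (evens p)`. The `shift` is the x² produced by
  -- multiplying two odd parts.
  evens-⊛ : ∀ p q i → evens (p ⊛ q) i ≡ (evens p ⊛ evens q) i + shift (odds p ⊛ odds q) i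
  evens-⊛ p q zero    = sym (ℤ.+-identityʳ _)
  evens-⊛ p q (suc i) = begin
    p 0 * evens q (suc i) + odds (tail p ⊛ q) i
      ≡⟨ cong (λ z → p 0 * evens q (suc i) + z) (odds-⊛ (tail p) q i) ⟩
    p 0 * evens q (suc i) + ((odds p ⊛ odds q) i + (tail (evens p) ⊛ evens q) i)
      ≡⟨ lemma (p 0 * evens q (suc i)) _ _ ⟩
    (p 0 * evens q (suc i) + (tail (evens p) ⊛ evens q) i) + (odds p ⊛ odds q) i ∎
    where
    open ≡-Reasoning
    lemma : ∀ a b c → a + (b + c) ≡ (a + c) + b
    lemma = solve-∀

  odds-⊛ : ∀ p q i → odds (p ⊛ q) i ≡ (evens p ⊛ odds q) i + (odds p ⊛ evens q) i
  odds-⊛ p q i = begin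
    p 0 * odds q i + evens (tail p ⊛ q) i
      ≡⟨ cong (λ z → p 0 * odds q i + z) (evens-⊛ (tail p) q i) ⟩
    p 0 * odds q i + ((odds p ⊛ evens q) i + shift (tail (evens p) ⊛ odds q) i)
      ≡⟨ lemma (p 0 * odds q i) _ _ ⟩
    (p 0 * odds q i + shift (tail (evens p) ⊛ odds q) i) + (odds p ⊛ evens q) i
      ≡⟨ cong (λ z → z + (odds p ⊛ evens q) i) (unfold (evens p) (odds q) i) ⟩
    (evens p ⊛ odds q) i + (odds p ⊛ evens q) i ∎
    where
    open ≡-Reasoning
    lemma : ∀ a b c → a + (b + c) ≡ (a + c) + b
    lemma = solve-∀
    unfold : ∀ p q i → p 0 * q i + shift (tail p ⊛ q) i ≡ (p ⊛ q) i
    unfold p q zero    = ℤ.+-identityʳ _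
    unfold p q (suc i) = refl

-- norm p at x² is p(x) p(−x).
norm : Series → Series
norm p = evens p ⊛ evens p ⊝ shift (odds p ⊛ odds p)

norm-X : ∀ p → norm p ≈ evens p ⊛ evens p ⊝ X ⊛ (odds p ⊛ odds p)
norm-X p = R.+-congˡ {evens p ⊛ evens p} (R.-‿cong (shift-⊛ (odds p ⊛ odds p)))

norm-⊛ : ∀ p q → norm (p ⊛ q) ≈ norm p ⊛ norm q
norm-⊛ p q = begin
  norm (p ⊛ q)
    ≈⟨ norm-X (p ⊛ q) ⟩
  evens (p ⊛ q) ⊛ evens (p ⊛ q) ⊝ X ⊛ (odds (p ⊛ q) ⊛ odds (p ⊛ q))
    ≈⟨ R.+-cong (⊛-cong evens≈ evens≈) (R.-‿cong (R.*-congˡ {X} (⊛-cong odds≈ odds≈))) ⟩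
  (a ⊛ c ⊕ X ⊛ (b ⊛ d)) ⊛ (a ⊛ c ⊕ X ⊛ (b ⊛ d)) ⊝ X ⊛ ((a ⊛ d ⊕ b ⊛ c) ⊛ (a ⊛ d ⊕ b ⊛ c))
    ≈⟨ norm-identity X a b c d ⟨
  (a ⊛ a ⊝ X ⊛ (b ⊛ b)) ⊛ (c ⊛ c ⊝ X ⊛ (d ⊛ d))
    ≈⟨ ⊛-cong (norm-X p) (norm-X q) ⟨
  norm p ⊛ norm q ∎
  where
  open import Relation.Binary.Reasoning.Setoid R.setoid
  a = evens p
  b = odds p
  c = evens q
  d = odds q
  odds≈ : odds (p ⊛ q) ≈ a ⊛ d ⊕ b ⊛ c
  odds≈ = ⟨ odds-⊛ p q ⟩
  evens≈ : evens (p ⊛ q) ≈ a ⊛ c ⊕ X ⊛ (b ⊛ d)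
  evens≈ = R.trans ⟨ evens-⊛ p q ⟩ (R.+-congˡ {a ⊛ c} (shift-⊛ (b ⊛ d)))

norm-cong : ∀ {p q} → p ≈ q → norm p ≈ norm q
norm-cong {p} {q} e = R.trans (norm-X p) (R.trans
  (R.+-cong (⊛-cong evens≈ evens≈) (R.-‿cong (R.*-congˡ {X} (⊛-cong odds≈ odds≈)))) (R.sym (norm-X q)))
  where
  evens≈ : evens p ≈ evens q
  evens≈ = ⟨ (λ i → at e (double i)) ⟩
  odds≈ : odds p ≈ odds q
  odds≈ = ⟨ (λ i → at e (suc (double i))) ⟩

inflate : Series → Series
inflate p zero          = p 0
inflate p (suc zero)    = 0ℤ
inflate p (suc (suc i)) = inflate (tail p) i

evens-inflate : ∀ p i → evens (inflate p) i ≡ p i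
evens-inflate p zero    = refl
evens-inflate p (suc i) = evens-inflate (tail p) i

odds-inflate : ∀ p i → odds (inflate p) i ≡ 0ℤ
odds-inflate p zero    = refl
odds-inflate p (suc i) = odds-inflate (tail p) i

by-parity : ∀ {p q} → (∀ i → evens p i ≡ evens q i) → (∀ i → odds p i ≡ odds q i) → p ≈ q
by-parity {p} {q} e o = ⟨ (λ i → go (parity i)) ⟩
  where
  go : ∀ {i} → Parity i → p i ≡ q i
  go (even j) = e j
  go (odd j)  = o j

norm-inflate : ∀ f → norm (inflate f) ≈ f ⊛ f
norm-inflate f = R.trans (R.+-cong (⊛-cong evens≈ evens≈) (R.-‿cong shift≈))
  ⟨ (λ { zero → ℤ.+-identityʳ _ ; (suc i) → ℤ.+-identityʳ _ }) ⟩
  where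
  evens≈ : evens (inflate f) ≈ f
  evens≈ = ⟨ evens-inflate f ⟩
  shift≈ : shift (odds (inflate f) ⊛ odds (inflate f)) ≈ const 0ℤ
  shift≈ = ⟨ (λ { zero → refl ; (suc i) → ⊛-zeroˡ _ (odds-inflate f) i }) ⟩

-- Sharper by one than `bounded-⊛`. In `norm-lead` this off-by-one is what makes the half of the
-- norm that does not lead vanish in the top degree.
bounded-⊛′ : ∀ {m n p q} → Bounded (suc m) p → Bounded n q → Bounded (m ℕ.+ n) (p ⊛ q)
bounded-⊛′ {zero} {n} {p} {q} b b′ i n≤i = trans (at (⊛-cong (constant-≈ (λ j → b (suc j) (s≤s z≤n))) (R.refl {q})) i)
  (trans (const-⊛ (p 0) q i) (trans (cong (p 0 *_) (b′ i n≤i)) (ℤ.*-zeroʳ (p 0))))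
bounded-⊛′ {suc m} {n} {p} {q} b b′ (suc i) (s≤s m+n≤i) = cong₂ _+_
  (trans (cong (p 0 *_) (b′ (suc i) (ℕ.≤-trans (ℕ.m≤n+m n m) (ℕ.m≤n⇒m≤1+n m+n≤i)))) (ℤ.*-zeroʳ (p 0)))
  (bounded-⊛′ {m} (λ j m≤j → b (suc j) (s≤s m≤j)) b′ i m+n≤i)

double-mono : ∀ {m n} → m ≤ n → double m ≤ double n
double-mono z≤n       = z≤n
double-mono (s≤s m≤n) = s≤s (s≤s (double-mono m≤n))

square≢0 : ∀ {a} → a ≢ 0ℤ → a * a ≢ 0ℤ
square≢0 {a} a≢0 e = Sum.[ a≢0 , a≢0 ] (ℤ.i*j≡0⇒i≡0∨j≡0 a e)

-- The norm preserves the degree: a² has even degree and x b² odd degree, so their leading terms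
-- cannot cancel, and the top coefficient is plus or minus the square of that of p.
norm-lead : ∀ p {b} → Bounded (suc b) p → p b ≢ 0ℤ → norm p b ≢ 0ℤ
norm-lead p {b} bounded lead≢0 = go (parity b) bounded lead≢0
  where
  go : ∀ {b} → Parity b → Bounded (suc b) p → p b ≢ 0ℤ → norm p b ≢ 0ℤ
  go (even j) bd l = λ z → square≢0 l (trans (sym top) (trans (sym (ℤ.+-identityʳ _))
                             (trans (cong (λ y → (evens p ⊛ evens p) (double j) - y) (sym (low j odds-bounded))) z)))
    where
    evens-bounded : Bounded (suc j) (evens p)
    evens-bounded i j<i = bd (double i) (ℕ.≤-trans (ℕ.n≤1+n _) (double-mono j<i))
    odds-bounded : Bounded j (odds p)
    odds-bounded i j≤i = bd (suc (double i)) (s≤s (double-mono j≤i))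
    top : (evens p ⊛ evens p) (double j) ≡ p (double j) * p (double j)
    top = trans (cong (evens p ⊛ evens p) (double≡+ j)) (top-coefficient evens-bounded evens-bounded)
    low : ∀ j → Bounded j (odds p) → shift (odds p ⊛ odds p) (double j) ≡ 0ℤ
    low zero    _ = refl
    low (suc j) o = bounded-⊛′ o o (suc (double j))
      (ℕ.≤-reflexive (trans (ℕ.+-suc j j) (cong suc (sym (double≡+ j)))))
  go (odd j) bd l = λ z → square≢0 l (trans (sym top) (ℤ.neg-injective
                            (trans (sym (ℤ.+-identityˡ _)) (trans (cong (λ y → y - (odds p ⊛ odds p) (double j)) (sym low))
                              z))))
    where
    evens-bounded : Bounded (suc j) (evens p)
    evens-bounded i j<i = bd (double i) (double-mono j<i)
    odds-bounded : Bounded (suc j) (odds p)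
    odds-bounded i j<i = bd (suc (double i)) (ℕ.≤-trans (double-mono j<i) (ℕ.n≤1+n _))
    top : (odds p ⊛ odds p) (double j) ≡ p (suc (double j)) * p (suc (double j))
    top = trans (cong (odds p ⊛ odds p) (double≡+ j)) (top-coefficient odds-bounded odds-bounded)
    low : (evens p ⊛ evens p) (suc (double j)) ≡ 0ℤ
    low = bounded-⊛′ evens-bounded evens-bounded (suc (double j))
      (ℕ.≤-reflexive (trans (ℕ.+-suc j j) (cong suc (sym (double≡+ j)))))

norm-constant : ∀ p → Finite p → Constant (norm p) → Constant p
norm-constant p (n , b) c with exact-degree n p b
... | inj₁ p≡0                           = λ i → p≡0 (suc i)
... | inj₂ (zero  , _ , lead≢0 , bounded) = λ i → bounded (suc i) (s≤s z≤n)
... | inj₂ (suc e , _ , lead≢0 , bounded) = contradiction (c e) (norm-lead p bounded lead≢0)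

finite-evens : ∀ {p} → Finite p → Finite (evens p)
finite-evens (n , b) = n , λ i n≤i → b (double i) (ℕ.≤-trans n≤i (subst (i ≤_) (sym (double≡+ i)) (ℕ.m≤m+n i i)))

finite-odds : ∀ {p} → Finite p → Finite (odds p)
finite-odds (n , b) = n , λ i n≤i → b (suc (double i))
  (ℕ.m≤n⇒m≤1+n (ℕ.≤-trans n≤i (subst (i ≤_) (sym (double≡+ i)) (ℕ.m≤m+n i i))))

finite-norm : ∀ {p} → Finite p → Finite (norm p)
finite-norm f = finite-⊕ (finite-⊛ (finite-evens f) (finite-evens f))
                         (finite-⊖ (finite-shift (finite-⊛ (finite-odds f) (finite-odds f))))

unit-square : ∀ {a b} → a * b ≡ 1ℤ → (a ≡ 1ℤ × b ≡ 1ℤ) ⊎ (a ≡ - 1ℤ × b ≡ - 1ℤ)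
unit-square {a} {b} e = go a (ℕ.m*n≡1⇒m≡1 ℤ.∣ a ∣ ℤ.∣ b ∣ (trans (sym (ℤ.abs-* a b)) (cong ℤ.∣_∣ e))) e
  where
  go : ∀ a → ℤ.∣ a ∣ ≡ 1 → a * b ≡ 1ℤ → (a ≡ 1ℤ × b ≡ 1ℤ) ⊎ (a ≡ - 1ℤ × b ≡ - 1ℤ)
  go (+ .1)        refl e = inj₁ (refl , trans (sym (ℤ.*-identityˡ b)) e)
  go (ℤ.-[1+ .0 ]) refl e = inj₂ (refl , ℤ.neg-injective (trans (sym (ℤ.-1*i≡-i b)) e))

-- Divisibility by 0 is vanishing, so cancelling f is the case c = 0 of `∣ˢ-cancel-monic`, applied
-- to p - q.
∣ᶠ-cancel : ∀ {f} p q → f 0 ≡ 1ℤ → f ⊛ p ≈ f ⊛ q → p ≈ q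
∣ᶠ-cancel {f} p q f0≡1 e = ⟨ (λ i → ℤ.i-j≡0⇒i≡j (p i) (q i) (0∣⇒≡0 (zero∣ i))) ⟩
  where
  distrib : ∀ f p q → f ⊛ (p ⊝ q) ≈ f ⊛ p ⊝ f ⊛ q
  distrib = solveˢ 3 (λ f p q → f :* (p :+ :- q) := f :* p :+ :- (f :* q)) R.refl
  zero∣ : 0ℤ ∣ˢ p ⊝ q
  zero∣ = ∣ˢ-cancel-monic (p ⊝ q) f0≡1 λ i → divides 0ℤ
    (trans (at (distrib f p q) i) (ℤ.i≡j⇒i-j≡0 (at e i)))

module _ {f : Series} {d : ℕ} (f-irreducible : IrreducibleSeries f) (f0≡1 : f 0 ≡ 1ℤ)
         (fd≢0 : f d ≢ 0ℤ) (f-bounded : Bounded (suc d) f) where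

  -- Writing norm p = f s and cancelling f from norm p · norm q = f² gives s · norm q = f, where
  -- irreducibility makes s or norm q constant. A constant s is 1 by comparing constant terms.
  norm-factor : ∀ p q → Finite p → Finite q → p 0 * q 0 ≡ 1ℤ → norm p ⊛ norm q ≈ f ⊛ f → f ∣ᶠ norm p →
                norm p ≈ f ⊎ Constant q
  norm-factor p q p-finite q-finite p0q0≡1 e (s , s-finite , norm-p≈fs) =
    Sum.map s-constant⇒ (norm-constant q q-finite)
      (f-irreducible s (norm q) s-finite (finite-norm q-finite) (R.sym s-norm-q≈f))
    where
    s-norm-q≈f : s ⊛ norm q ≈ f
    s-norm-q≈f = ∣ᶠ-cancel (s ⊛ norm q) f f0≡1
      (R.trans (R.sym (R.*-assoc f s (norm q))) (R.trans (R.*-congʳ (R.sym norm-p≈fs)) e))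
    -- The constant term of the norm is (p 0)² with `p 0` = ±1, which excludes norm p = -f.
    norm-p0≡1 : norm p 0 ≡ 1ℤ
    norm-p0≡1 with unit-square {p 0} p0q0≡1
    ... | inj₁ (p0≡1 , _) rewrite p0≡1 = refl
    ... | inj₂ (p0≡-1 , _) rewrite p0≡-1 = refl
    s-constant⇒ : Constant s → norm p ≈ f
    s-constant⇒ c = R.trans norm-p≈fs (R.trans (R.*-congˡ (R.trans (constant-≈ c) (R.reflexive (cong const s0≡1))))
                                               (R.*-identityʳ f))
      where
      s0≡1 : s 0 ≡ 1ℤ
      s0≡1 = trans (sym (ℤ.*-identityˡ (s 0)))
               (trans (cong (_* s 0) (sym f0≡1)) (trans (sym (at norm-p≈fs 0)) norm-p0≡1))

  inflate-irreducible : (∀ p → Finite p → ¬ (norm p ≈ f)) → IrreducibleSeries (inflate f)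
  inflate-irreducible not-norm p q p-finite q-finite e =
    Sum.[ (λ f∣p → Sum.map₁ {B = Constant q} (λ { n≈f → contradiction n≈f (not-norm p p-finite) })
                    (norm-factor p q p-finite q-finite p0q0≡1 norms f∣p))
        , (λ f∣q → Sum.swap (Sum.map₁ {B = Constant p} (λ { n≈f → contradiction n≈f (not-norm q q-finite) })
                    (norm-factor q p q-finite p-finite (trans (ℤ.*-comm (q 0) (p 0)) p0q0≡1)
                       (R.trans (R.*-comm (norm q) (norm p)) norms) f∣q)))
        ]
      (irreducible⇒prime {f} {d} f-irreducible f0≡1 fd≢0 f-bounded {norm q} (finite-norm q-finite)
        (norm p) (finite-norm p-finite) (f , (suc d , f-bounded) , norms))
    where
    p0q0≡1 : p 0 * q 0 ≡ 1ℤ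
    p0q0≡1 = trans (sym (at e 0)) f0≡1
    norms : norm p ⊛ norm q ≈ f ⊛ f
    norms = R.trans (R.sym (norm-⊛ p q)) (R.trans (norm-cong (R.sym e)) (norm-inflate f))

-- Squares modulo 4

SquareMod4 : Series → Set
SquareMod4 f = ∃ λ e → + 4 ∣ˢ f ⊝ e ⊛ e

2∣1⇒⊥ : ¬ (+ 2 ∣ₛ 1ℤ)
2∣1⇒⊥ 2∣1 = contradiction (ℕ.∣1⇒≡1 (∣⇒∣ᵤ 2∣1)) λ ()

4∣⇒2∣ : ∀ {x} → + 4 ∣ₛ x → + 2 ∣ₛ x
4∣⇒2∣ = ∣-trans (divides (+ 2) refl)

4∣-square : ∀ {p} → + 2 ∣ˢ p → + 4 ∣ˢ p ⊛ p
4∣-square {p} 2∣p =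
  let c , p≈2c = ∣ˢ-quotient 2∣p
  in λ i → subst (+ 4 ∣ₛ_)
       (sym (at (R.trans (⊛-cong p≈2c p≈2c)
          (R.trans (⊛-square (const (+ 2)) c) (R.*-congʳ (R.sym (const-* (+ 2) (+ 2)))))) i))
       (∣ˢ-const-⊛ (+ 4) (c ⊛ c) i)
  where
  ⊛-square : ∀ t c → (t ⊛ c) ⊛ (t ⊛ c) ≈ (t ⊛ t) ⊛ (c ⊛ c)
  ⊛-square = solveˢ 2 (λ t c → (t :* c) :* (t :* c) := (t :* t) :* (c :* c)) R.refl

∣-shift : ∀ {c p} → c ∣ˢ p → c ∣ˢ shift p
∣-shift c∣p zero    = divides 0ℤ refl
∣-shift c∣p (suc i) = c∣p i

∣ˢ-by-parity : ∀ {c p} → c ∣ˢ evens p → c ∣ˢ odds p → c ∣ˢ p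
∣ˢ-by-parity {c} {p} e o i = go (parity i)
  where
  go : ∀ {i} → Parity i → c ∣ₛ p i
  go (even j) = e j
  go (odd j)  = o j

odds-square : ∀ p i → odds (p ⊛ p) i ≡ (evens p ⊛ odds p) i * + 2
odds-square p i = trans (odds-⊛ p p i) (trans (cong (λ z → (evens p ⊛ odds p) i + z) (⊛-comm (odds p) (evens p) i))
  (lemma ((evens p ⊛ odds p) i)))
  where
  lemma : ∀ a → a + a ≡ a * + 2
  lemma = solve-∀

norm≈inflate⇒squareMod4 : ∀ {p f} → Finite p → norm p ≈ inflate f → SquareMod4 (inflate f)
norm≈inflate⇒squareMod4 {p} {f} p-finite e = a , λ i → subst (+ 4 ∣ₛ_)
  (trans (lemma ((a ⊛ a) i) (shift (b ⊛ b) i)) (cong (λ z → z - (a ⊛ a) i) (at e i)))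
  (∣m⇒∣-m (∣-shift (4∣-square 2∣b) i))
  where
  a = evens p
  b = odds p
  lemma : ∀ x y → - y ≡ (x - y) - x
  lemma = solve-∀
  -- An inflated series has no odd coefficients, so those of a² and x b² agree: the even part of b²
  -- equals the odd part of the square a², which is twice a product.
  2∣evens : + 2 ∣ˢ evens (b ⊛ b)
  2∣evens i = divides ((evens a ⊛ odds a) i) (trans
    (sym (ℤ.i-j≡0⇒i≡j (odds (a ⊛ a) i) (evens (b ⊛ b) i) (trans (at e (suc (double i))) (odds-inflate f i))))
    (odds-square a i))
  2∣odds : + 2 ∣ˢ odds (b ⊛ b)
  2∣odds i = divides ((evens b ⊛ odds b) i) (odds-square b i)
  2∣b : + 2 ∣ˢ b
  2∣b = Sum.reduce
          (prime-∣ˢ-⊛ prime[2] b b (proj₂ (finite-odds p-finite)) (∣ˢ-by-parity 2∣evens 2∣odds))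

-- Split e into a(x²) + x b(x²). The odd part of e² is 2ab and must vanish modulo 4, so 2 divides
-- ab. Since a(0)² ≡ f(0) = 1 makes a(0) odd, 2 divides b. Then x b² vanishes modulo 4 and f ≡ a².
squareMod4-deflate : ∀ {f} → f 0 ≡ 1ℤ → SquareMod4 (inflate f) → SquareMod4 f
squareMod4-deflate {f} f0≡1 (e , d) = a , λ i → subst (+ 4 ∣ₛ_)
  (trans (cong₂ (λ x y → x - y + shift (b ⊛ b) i) (evens-inflate f i) (evens-⊛ e e i))
         (lemma (f i) ((a ⊛ a) i) (shift (b ⊛ b) i)))
  (∣m∣n⇒∣m+n (d (double i)) (∣-shift (4∣-square 2∣b) i))
  where
  a = evens e
  b = odds e
  lemma : ∀ x y z → x - (y + z) + z ≡ x - y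
  lemma = solve-∀
  2∤a0 : ¬ (+ 2 ∣ₛ a 0)
  2∤a0 2∣a0 = 2∣1⇒⊥ (subst (+ 2 ∣ₛ_) f0≡1 (∣m+n∣n⇒∣m (4∣⇒2∣ (d 0)) (∣m⇒∣-m (∣m⇒∣m*n (e 0) 2∣a0))))
  2∣ab : + 2 ∣ˢ a ⊛ b
  2∣ab i = *-cancelʳ-∣ (+ 2) {+ 2} (subst (+ 4 ∣ₛ_)
    (trans (cong -_ (trans (cong (λ z → z - odds (e ⊛ e) i) (odds-inflate f i)) (ℤ.+-identityˡ _)))
      (trans (ℤ.neg-involutive _) (odds-square e i)))
    (∣m⇒∣-m (d (suc (double i)))))
  2∣b : + 2 ∣ˢ b
  2∣b = ∣ˢ-cancel b (λ x 2∣a0x → Sum.[ (λ 2∣a0 → contradiction 2∣a0 2∤a0) , (λ z → z) ]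
                                     (euclid prime[2] (a 0) x 2∣a0x)) 2∣ab

quartic : ℤ → Series
quartic A 0 = 1ℤ
quartic A 1 = A
quartic A 2 = A
quartic A 3 = A
quartic A 4 = 1ℤ
quartic A _ = 0ℤ

quartic-bounded : ∀ A → Bounded 5 (quartic A)
quartic-bounded A _ (s≤s (s≤s (s≤s (s≤s (s≤s z≤n))))) = refl

¬squareMod4-quartic : ∀ {A} → ¬ (+ 2 ∣ₛ A) → ¬ SquareMod4 (quartic A)
¬squareMod4-quartic {A} 2∤A (e , d) = 2∤A (∣m+n∣n⇒∣m (4∣⇒2∣ (d 3)) (∣m⇒∣-m
  (divides (e 0 * e 3 + e 1 * e 2) (lemma (e 0) (e 1) (e 2) (e 3)))))
  where
  lemma : ∀ a b c d → a * d + (b * c + (c * b + d * a)) ≡ (a * d + b * c) * + 2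
  lemma = solve-∀

-- Quartics that are norms

square≡+ : ∀ x → x * x ≡ + (ℤ.∣ x ∣ ℕ.* ℤ.∣ x ∣)
square≡+ (+ n)      = sym (ℤ.pos-* n n)
square≡+ ℤ.-[1+ n ] = refl

-- The difference of the equations is b² - (m - 1)² = 1. Two integers with product 1 are equal, so m
-- = 1 and b² = 1, whence A = 2 - 1.
equal-signs-same : ∀ {A} m b → + 2 * m - b * b ≡ A → m * m + + 2 - + 2 * (b * b) ≡ A → A ≡ 1ℤ
equal-signs-same {A} m b e₁ e₂ = trans (sym e₁) (trans (rearrange m b)
    (cong₂ (λ x n → + 2 - x + + 2 * n - n * n) product≡1 m-1≡0))
  where
  rearrange : ∀ m b → + 2 * m - b * b
    ≡ + 2 - (b - (m - 1ℤ)) * (b + (m - 1ℤ)) + + 2 * (m - 1ℤ) - (m - 1ℤ) * (m - 1ℤ)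
  rearrange = solve-∀
  difference : ∀ m b → (b - (m - 1ℤ)) * (b + (m - 1ℤ))
    ≡ 1ℤ + ((+ 2 * m - b * b) - (m * m + + 2 - + 2 * (b * b)))
  difference = solve-∀
  product≡1 : (b - (m - 1ℤ)) * (b + (m - 1ℤ)) ≡ 1ℤ
  product≡1 = trans (difference m b) (cong (λ z → 1ℤ + z) (ℤ.i≡j⇒i-j≡0 (trans e₁ (sym e₂))))
  twice : ∀ m b → + 2 * (m - 1ℤ) ≡ (b + (m - 1ℤ)) - (b - (m - 1ℤ))
  twice = solve-∀
  m-1≡0 : m - 1ℤ ≡ 0ℤ
  m-1≡0 = Sum.[ (λ ()) , (λ z → z) ] (ℤ.i*j≡0⇒i≡0∨j≡0 (+ 2) {m - 1ℤ} (trans (twice m b)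
    (Sum.[ (λ (x , y) → cong₂ _-_ y x) , (λ (x , y) → cong₂ _-_ y x) ] (unit-square {b - (m - 1ℤ)} product≡1))))

-- The difference of the equations would be 1 + (m - 1)² + 3b² = 0.
equal-signs-opposite : ∀ {A} m b → + 2 * m - b * b ≡ A → ¬ (m * m + + 2 + + 2 * (b * b) ≡ A)
equal-signs-opposite {A} m b e₁ e₂ = contradiction
    (trans (sym (cong₂ (λ x y → 1ℤ + x + y) (square≡+ (m - 1ℤ))
                  (trans (cong (+ 3 *_) (square≡+ b)) (sym (ℤ.pos-* 3 (ℤ.∣ b ∣ ℕ.* ℤ.∣ b ∣))))))
      (trans (difference m b) (ℤ.i≡j⇒i-j≡0 (trans e₂ (sym e₁)))))
    λ ()
  where
  difference : ∀ m b → 1ℤ + (m - 1ℤ) * (m - 1ℤ) + + 3 * (b * b) ≡ (m * m + + 2 + + 2 * (b * b)) - (+ 2 * m - b * b)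
  difference = solve-∀

-- The case p₀ = p₄ of norm p = g, with m = p₀p₂, b = p₁ and c = p₃. The coefficients of x and x³
-- give b² = c², so b = ±c.
equal-signs : ∀ {A} m b c → + 2 * m - b * b ≡ A → + 2 * m - c * c ≡ A → m * m + + 2 - + 2 * (b * c) ≡ A → A ≡ 1ℤ
equal-signs {A} m b c e₁ e₂ e₃ = Sum.[ same , opposite ] (ℤ.i*j≡0⇒i≡0∨j≡0 (b - c) (trans (factor m b c)
    (ℤ.i≡j⇒i-j≡0 (trans e₂ (sym e₁)))))
  where
  factor : ∀ m b c → (b - c) * (b + c) ≡ (+ 2 * m - c * c) - (+ 2 * m - b * b)
  factor = solve-∀
  same : b - c ≡ 0ℤ → A ≡ 1ℤ
  same z with ℤ.i-j≡0⇒i≡j b c z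
  ... | refl = equal-signs-same m b e₁ e₃
  negate : ∀ m b c → m * m + + 2 + + 2 * (b * b) ≡ (m * m + + 2 - + 2 * (b * c)) + + 2 * (b * (b + c))
  negate = solve-∀
  opposite : b + c ≡ 0ℤ → A ≡ 1ℤ
  opposite z = contradiction
    (trans (negate m b c) (trans (cong₂ (λ x y → x + + 2 * y) e₃ (trans (cong (b *_) z) (ℤ.*-zeroʳ b)))
                              (ℤ.+-identityʳ A)))
    (equal-signs-opposite m b e₁)

-- Read as (4 - n²) W = 16: for n = 0 and n = 1 the left side is at least 48 and 36, and for n ≥ 2
-- it is not positive.
16+n²W≢4W : ∀ n W → 12 ≤ W → 16 ℕ.+ n ℕ.* n ℕ.* W ≢ 4 ℕ.* W
16+n²W≢4W 0 W 12≤W e = contradiction (subst (48 ≤_) (sym e) (ℕ.*-monoʳ-≤ 4 12≤W)) (ℕ.<⇒≱ (ℕ.m≤m+n 17 31))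
16+n²W≢4W 1 W 12≤W e = contradiction (subst (36 ≤_) 3W≡16 (ℕ.*-monoʳ-≤ 3 12≤W)) (ℕ.<⇒≱ (ℕ.m≤m+n 17 19))
  where
  3W≡16 : 3 ℕ.* W ≡ 16
  3W≡16 = sym (ℕ.+-cancelʳ-≡ W 16 (3 ℕ.* W)
    (trans (cong (16 ℕ.+_) (sym (ℕ.+-identityʳ W))) (trans e (ℕ.+-comm W (3 ℕ.* W)))))
16+n²W≢4W (suc (suc n)) W 12≤W e = ℕ.<⇒≱ (ℕ.m<n+m (4 ℕ.* W) {16} (s≤s z≤n))
  (ℕ.≤-trans (ℕ.+-monoʳ-≤ 16 (ℕ.*-monoˡ-≤ W (ℕ.*-mono-≤ 2≤n 2≤n))) (ℕ.≤-reflexive e))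
  where
  2≤n : 2 ≤ suc (suc n)
  2≤n = s≤s (s≤s z≤n)

16+u²w≢4w : ∀ u v → + 16 + u * u * (+ 12 + v * v) ≢ + 4 * (+ 12 + v * v)
16+u²w≢4w u v e = 16+n²W≢4W ℤ.∣ u ∣ W (ℕ.m≤m+n 12 _) (ℤ.+-injective (begin
  + (16 ℕ.+ ℤ.∣ u ∣ ℕ.* ℤ.∣ u ∣ ℕ.* W)     ≡⟨ cong (λ z → + 16 + z) (ℤ.pos-* (ℤ.∣ u ∣ ℕ.* ℤ.∣ u ∣) W) ⟩
  + 16 + + (ℤ.∣ u ∣ ℕ.* ℤ.∣ u ∣) * + W     ≡⟨ cong₂ (λ x y → + 16 + x * (+ 12 + y)) (square≡+ u) (square≡+ v) ⟨
  + 16 + u * u * (+ 12 + v * v)            ≡⟨ e ⟩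
  + 4 * (+ 12 + v * v)                     ≡⟨ cong (λ z → + 4 * (+ 12 + z)) (square≡+ v) ⟩
  + 4 * + W                                ≡⟨ ℤ.pos-* 4 W ⟨
  + (4 ℕ.* W)                              ∎))
  where
  open ≡-Reasoning
  W = 12 ℕ.+ ℤ.∣ v ∣ ℕ.* ℤ.∣ v ∣

-- In u = c − b and v = c + b the three equations combine to (4 − u²)(12 + v²) = 16.
opposite-signs : ∀ {A} m b c → + 2 * m - b * b ≡ A → - (+ 2 * m) - c * c ≡ A →
                 ¬ (m * m - + 2 - + 2 * (b * c) ≡ A)
opposite-signs {A} m b c e₁ e₂ e₃ = 16+u²w≢4w (c - b) (c + b) (ℤ.i-j≡0⇒i≡j _ _ (begin
  + 16 + (c - b) * (c - b) * (+ 12 + (c + b) * (c + b)) - + 4 * (+ 12 + (c + b) * (c + b))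
    ≡⟨ combination m b c A ⟩
  combine (m * m - + 2 - + 2 * (b * c) - A) (+ 2 * m - b * b - A) (- (+ 2 * m) - c * c - A)
    ≡⟨ cong₂ (λ (x , y) z → combine x y z) (cong₂ _,_ (ℤ.i≡j⇒i-j≡0 e₃) (ℤ.i≡j⇒i-j≡0 e₁)) (ℤ.i≡j⇒i-j≡0 e₂) ⟩
  0ℤ ∎))
  where
  open ≡-Reasoning
  -- The arguments are the defects of the third, first and second equation. The weights 16 and -8
  -- eliminate A. As y - z = 4m + uv, the last product is u²v² - 16m², which trades 16m² for u²v².
  combine : ℤ → ℤ → ℤ → ℤ
  combine x y z = + 16 * x - + 8 * (y + z) + (y - z) * (y - z - + 8 * m)
  combination : ∀ m b c A →
    + 16 + (c - b) * (c - b) * (+ 12 + (c + b) * (c + b)) - + 4 * (+ 12 + (c + b) * (c + b))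
    ≡ + 16 * (m * m - + 2 - + 2 * (b * c) - A)
      - + 8 * ((+ 2 * m - b * b - A) + (- (+ 2 * m) - c * c - A))
      + ((+ 2 * m - b * b - A) - (- (+ 2 * m) - c * c - A))
        * ((+ 2 * m - b * b - A) - (- (+ 2 * m) - c * c - A) - + 8 * m)
  combination = solve-∀

-- Both p₀ and p₄ are ±1. Taking m = p₀p₂ reduces the four sign patterns to two: equal signs and
-- opposite signs.
quartic-norm-equations : ∀ {A} p₀ p₁ p₂ p₃ p₄ → p₀ * p₀ ≡ 1ℤ → p₄ * p₄ ≡ 1ℤ →
  + 2 * (p₀ * p₂) - p₁ * p₁ ≡ A → p₂ * p₂ + + 2 * (p₀ * p₄) - + 2 * (p₁ * p₃) ≡ A →
  + 2 * (p₄ * p₂) - p₃ * p₃ ≡ A → A ≡ 1ℤ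
quartic-norm-equations p₀ p₁ p₂ p₃ p₄ e₀ e₄ e₁ e₂ e₃ with unit-square {p₀} e₀ | unit-square {p₄} e₄
... | inj₁ (refl , _) | inj₁ (refl , _) = equal-signs p₂ p₁ p₃
        (trans (f p₂ p₁) e₁) (trans (f p₂ p₃) e₃) e₂
  where
  f : ∀ m b → + 2 * m - b * b ≡ + 2 * (1ℤ * m) - b * b
  f = solve-∀
... | inj₂ (refl , _) | inj₂ (refl , _) = equal-signs (- p₂) p₁ p₃
        (trans (f p₂ p₁) e₁) (trans (f p₂ p₃) e₃) (trans (g p₂ p₁ p₃) e₂)
  where
  f : ∀ m b → + 2 * - m - b * b ≡ + 2 * (- 1ℤ * m) - b * b
  f = solve-∀
  g : ∀ m b c → - m * - m + + 2 - + 2 * (b * c) ≡ m * m + + 2 - + 2 * (b * c)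
  g = solve-∀
... | inj₁ (refl , _) | inj₂ (refl , _) = contradiction e₂ (opposite-signs p₂ p₁ p₃
        (trans (f p₂ p₁) e₁) (trans (g p₂ p₃) e₃))
  where
  f : ∀ m b → + 2 * m - b * b ≡ + 2 * (1ℤ * m) - b * b
  f = solve-∀
  g : ∀ m b → - (+ 2 * m) - b * b ≡ + 2 * (- 1ℤ * m) - b * b
  g = solve-∀
... | inj₂ (refl , _) | inj₁ (refl , _) = contradiction (trans (h p₂ p₁ p₃) e₂) (opposite-signs (- p₂) p₁ p₃
        (trans (f p₂ p₁) e₁) (trans (g p₂ p₃) e₃))
  where
  f : ∀ m b → + 2 * - m - b * b ≡ + 2 * (- 1ℤ * m) - b * b
  f = solve-∀
  g : ∀ m b → - (+ 2 * - m) - b * b ≡ + 2 * (1ℤ * m) - b * b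
  g = solve-∀
  h : ∀ m b c → - m * - m - + 2 - + 2 * (b * c) ≡ m * m - + 2 - + 2 * (b * c)
  h = solve-∀

-- The coefficients of `norm p` up to x⁴ involve those of p up to index 8. As the norm preserves the
-- degree, the ones beyond index 4 vanish.
norm≈quartic⇒bounded : ∀ {A p} → Finite p → norm p ≈ quartic A → Bounded 5 p
norm≈quartic⇒bounded {A} {p} (n , b) e = go (exact-degree n p b)
  where
  go : (∀ i → p i ≡ 0ℤ) ⊎ (∃ λ d → d < n × p d ≢ 0ℤ × Bounded (suc d) p) → Bounded 5 p
  go (inj₁ p≡0) i _ = p≡0 i
  go (inj₂ (d , _ , lead≢0 , bounded)) with d ℕ.≤? 4
  ... | yes d≤4 = bounded-mono (s≤s d≤4) bounded
  ... | no  d≰4 = contradiction (trans (at e d) (quartic-bounded A d (ℕ.≰⇒> d≰4))) (norm-lead p bounded lead≢0)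

norm≈quartic⇒A≡1 : ∀ {A p} → Finite p → norm p ≈ quartic A → A ≡ 1ℤ
norm≈quartic⇒A≡1 {A} {p} p-finite e = quartic-norm-equations (p 0) (p 1) (p 2) (p 3) (p 4)
  (trans (sym (ℤ.+-identityʳ _)) (at e 0))
  (trans (c₄ (p 0) (p 1) (p 2) (p 3) (p 4) (z 0) (z 1) (z 2) (z 3)) (at e 4))
  (trans (c₁ (p 0) (p 1) (p 2)) (at e 1))
  (trans (c₂ (p 0) (p 1) (p 2) (p 3) (p 4)) (at e 2))
  (trans (c₃ (p 0) (p 1) (p 2) (p 3) (p 4) (z 0) (z 1)) (at e 3))
  where
  z : ∀ i → p (5 ℕ.+ i) ≡ 0ℤ
  z i = norm≈quartic⇒bounded p-finite e (5 ℕ.+ i) (ℕ.m≤m+n 5 i)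
  c₁ : ∀ a b c → + 2 * (a * c) - b * b ≡ a * c + c * a - b * b
  c₁ = solve-∀
  c₂ : ∀ a b c d e → c * c + + 2 * (a * e) - + 2 * (b * d) ≡ a * e + (c * c + e * a) - (b * d + d * b)
  c₂ = solve-∀
  c₃ : ∀ a b c d e {f g} → f ≡ 0ℤ → g ≡ 0ℤ →
    + 2 * (e * c) - d * d ≡ a * g + (c * e + (e * c + g * a)) - (b * f + (d * d + f * b))
  c₃ a b c d e refl refl = lemma a b c d e
    where
    lemma : ∀ a b c d e → + 2 * (e * c) - d * d ≡ a * 0ℤ + (c * e + (e * c + 0ℤ * a)) - (b * 0ℤ + (d * d + 0ℤ * b))
    lemma = solve-∀
  c₄ : ∀ a b c d e {f g h i} → f ≡ 0ℤ → g ≡ 0ℤ → h ≡ 0ℤ → i ≡ 0ℤ →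
    e * e ≡ a * i + (c * g + (e * e + (g * c + i * a))) - (b * h + (d * f + (f * d + h * b)))
  c₄ a b c d e refl refl refl refl = lemma a b c d e
    where
    lemma : ∀ a b c d e → e * e ≡ a * 0ℤ + (c * 0ℤ + (e * e + (0ℤ * c + 0ℤ * a)))
                                  - (b * 0ℤ + (d * 0ℤ + (0ℤ * d + 0ℤ * b)))
    lemma = solve-∀

-- Irreducibility over ℤ

odd⇒2q+1 : ∀ {x} → ¬ (+ 2 ∣ₛ x) → ∃ λ q → x ≡ 1ℤ + q * + 2
odd⇒2q+1 {x} 2∤x = go (x %ℕ 2) (n%ℕd<d x 2) (a≡a%ℕn+[a/ℕn]*n x 2)
  where
  go : ∀ r → r < 2 → x ≡ + r + (x /ℕ 2) * + 2 → ∃ λ q → x ≡ 1ℤ + q * + 2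
  go 0 _ e = contradiction (divides (x /ℕ 2) (trans e (ℤ.+-identityˡ _))) 2∤x
  go 1 _ e = x /ℕ 2 , e
  go (suc (suc r)) (s≤s (s≤s ())) _

odd+odd : ∀ {a b} → ¬ (+ 2 ∣ₛ a) → ¬ (+ 2 ∣ₛ b) → + 2 ∣ₛ a + b
odd+odd 2∤a 2∤b with odd⇒2q+1 2∤a | odd⇒2q+1 2∤b
... | q , refl | r , refl = divides (1ℤ + q + r) (lemma q r)
  where
  lemma : ∀ q r → (1ℤ + q * + 2) + (1ℤ + r * + 2) ≡ (1ℤ + q + r) * + 2
  lemma = solve-∀

unit-odd : ∀ {a b} → a * b ≡ 1ℤ → ¬ (+ 2 ∣ₛ a)
unit-odd {a} {b} e 2∣a = 2∣1⇒⊥ (subst (+ 2 ∣ₛ_) e (∣m⇒∣m*n b 2∣a))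

module _ {A} (2∤A : ¬ (+ 2 ∣ₛ A)) where

  -- Evaluate at 1: g(1) = 2 + 3A is odd, whereas p(1) = p₀ + p₁ is a sum of two units and hence
  -- even.
  linear-factor : ∀ p₀ p₁ q₀ q₁ q₂ q₃ → p₀ * q₀ ≡ 1ℤ → p₀ * q₁ + p₁ * q₀ ≡ A → p₀ * q₂ + p₁ * q₁ ≡ A →
                  p₀ * q₃ + p₁ * q₂ ≡ A → ¬ (p₁ * q₃ ≡ 1ℤ)
  linear-factor p₀ p₁ q₀ q₁ q₂ q₃ e₀ e₁ e₂ e₃ e₄ = 2∤A (∣m+n∣m⇒∣n {m = + 2 + + 2 * A}
    (subst (+ 2 ∣ₛ_) (trans (sum p₀ p₁ q₀ q₁ q₂ q₃)
                       (trans (cong₂ _+_ (cong₂ _+_ (cong₂ _+_ e₀ e₄) (cong₂ _+_ e₁ e₂)) e₃) (total A)))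
      (∣m⇒∣m*n (q₀ + q₁ + q₂ + q₃) (odd+odd (unit-odd {p₀} e₀) (unit-odd {p₁} e₄))))
    (∣m∣n⇒∣m+n (divides 1ℤ refl) (divides A (ℤ.*-comm (+ 2) A))))
    where
    sum : ∀ p₀ p₁ q₀ q₁ q₂ q₃ → (p₀ + p₁) * (q₀ + q₁ + q₂ + q₃)
      ≡ p₀ * q₀ + p₁ * q₃ + ((p₀ * q₁ + p₁ * q₀) + (p₀ * q₂ + p₁ * q₁)) + (p₀ * q₃ + p₁ * q₂)
    sum = solve-∀
    total : ∀ A → 1ℤ + 1ℤ + (A + A) + A ≡ + 2 + + 2 * A + A
    total = solve-∀

  -- The outer coefficients are units, hence odd. The x²-coefficient A is odd and p₀q₂ + p₂q₀ is
  -- even, so p₁ and q₁ are odd; but then the x-coefficient p₀q₁ + p₁q₀ = A is even.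
  quadratic-factor : ∀ p₀ p₁ p₂ q₀ q₁ q₂ → p₀ * q₀ ≡ 1ℤ → p₀ * q₁ + p₁ * q₀ ≡ A →
                     p₀ * q₂ + (p₁ * q₁ + p₂ * q₀) ≡ A → ¬ (p₂ * q₂ ≡ 1ℤ)
  quadratic-factor p₀ p₁ p₂ q₀ q₁ q₂ e₀ e₁ e₂ e₄ = 2∤A (subst (+ 2 ∣ₛ_) e₁ (sum-even (unit-square {p₀} e₀)))
    where
    2∣outer : + 2 ∣ₛ p₀ * q₂ + p₂ * q₀
    2∣outer = odd+odd (λ d → Sum.[ unit-odd e₀ , unit-odd (trans (ℤ.*-comm q₂ p₂) e₄) ] (euclid prime[2] p₀ q₂ d))
                      (λ d → Sum.[ unit-odd e₄ , unit-odd (trans (ℤ.*-comm q₀ p₀) e₀) ] (euclid prime[2] p₂ q₀ d))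
    2∤inner : ¬ (+ 2 ∣ₛ p₁ * q₁)
    2∤inner d = 2∤A (subst (+ 2 ∣ₛ_) (trans (rearrange (p₀ * q₂) (p₂ * q₀) (p₁ * q₁)) e₂) (∣m∣n⇒∣m+n 2∣outer d))
      where
      rearrange : ∀ a b c → a + b + c ≡ a + (c + b)
      rearrange = solve-∀
    2∣p₁+q₁ : + 2 ∣ₛ q₁ + p₁
    2∣p₁+q₁ = odd+odd (λ d → 2∤inner (∣n⇒∣m*n p₁ d)) (λ d → 2∤inner (∣m⇒∣m*n q₁ d))
    sum-even : (p₀ ≡ 1ℤ × q₀ ≡ 1ℤ) ⊎ (p₀ ≡ - 1ℤ × q₀ ≡ - 1ℤ) → + 2 ∣ₛ p₀ * q₁ + p₁ * q₀
    sum-even (inj₁ (refl , refl)) = subst (+ 2 ∣ₛ_) (lemma q₁ p₁) 2∣p₁+q₁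
      where
      lemma : ∀ x y → x + y ≡ 1ℤ * x + y * 1ℤ
      lemma = solve-∀
    sum-even (inj₂ (refl , refl)) = subst (+ 2 ∣ₛ_) (lemma q₁ p₁) (∣m⇒∣-m 2∣p₁+q₁)
      where
      lemma : ∀ x y → - (x + y) ≡ - 1ℤ * x + y * - 1ℤ
      lemma = solve-∀

  no-linear-factor : ∀ p q → Bounded 2 p → Bounded 4 q → ¬ (quartic A ≈ p ⊛ q)
  no-linear-factor p q bp bq e = go (p 0) (p 1) (q 0) (q 1) (q 2) (q 3)
      (bp 2 (ℕ.m≤m+n 2 0)) (bp 3 (ℕ.m≤m+n 2 1)) (bp 4 (ℕ.m≤m+n 2 2)) (bq 4 (ℕ.m≤m+n 4 0))
      (at e 0) (at e 1) (at e 2) (at e 3) (at e 4)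
    where
    go : ∀ p₀ p₁ q₀ q₁ q₂ q₃ {p₂ p₃ p₄ q₄} → p₂ ≡ 0ℤ → p₃ ≡ 0ℤ → p₄ ≡ 0ℤ → q₄ ≡ 0ℤ →
      1ℤ ≡ p₀ * q₀ → A ≡ p₀ * q₁ + p₁ * q₀ → A ≡ p₀ * q₂ + (p₁ * q₁ + p₂ * q₀) →
      A ≡ p₀ * q₃ + (p₁ * q₂ + (p₂ * q₁ + p₃ * q₀)) →
      ¬ (1ℤ ≡ p₀ * q₄ + (p₁ * q₃ + (p₂ * q₂ + (p₃ * q₁ + p₄ * q₀))))
    go p₀ p₁ q₀ q₁ q₂ q₃ refl refl refl refl e₀ e₁ e₂ e₃ e₄ =
      linear-factor p₀ p₁ q₀ q₁ q₂ q₃ (sym e₀) (sym e₁) (sym (trans e₂ (l₂ p₀ p₁ q₀ q₁ q₂)))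
        (sym (trans e₃ (l₃ p₀ p₁ q₀ q₁ q₂ q₃))) (sym (trans e₄ (l₄ p₀ p₁ q₀ q₁ q₂ q₃)))
      where
      l₂ : ∀ p₀ p₁ q₀ q₁ q₂ → p₀ * q₂ + (p₁ * q₁ + 0ℤ * q₀) ≡ p₀ * q₂ + p₁ * q₁
      l₂ = solve-∀
      l₃ : ∀ p₀ p₁ q₀ q₁ q₂ q₃ → p₀ * q₃ + (p₁ * q₂ + (0ℤ * q₁ + 0ℤ * q₀)) ≡ p₀ * q₃ + p₁ * q₂
      l₃ = solve-∀
      l₄ : ∀ p₀ p₁ q₀ q₁ q₂ q₃ → p₀ * 0ℤ + (p₁ * q₃ + (0ℤ * q₂ + (0ℤ * q₁ + 0ℤ * q₀))) ≡ p₁ * q₃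
      l₄ = solve-∀

  no-quadratic-factor : ∀ p q → Bounded 3 p → Bounded 3 q → ¬ (quartic A ≈ p ⊛ q)
  no-quadratic-factor p q bp bq e = go (p 0) (p 1) (p 2) (q 0) (q 1) (q 2)
      (bp 3 (ℕ.m≤m+n 3 0)) (bp 4 (ℕ.m≤m+n 3 1)) (bq 3 (ℕ.m≤m+n 3 0)) (bq 4 (ℕ.m≤m+n 3 1))
      (at e 0) (at e 1) (at e 2) (at e 4)
    where
    go : ∀ p₀ p₁ p₂ q₀ q₁ q₂ {p₃ p₄ q₃ q₄} → p₃ ≡ 0ℤ → p₄ ≡ 0ℤ → q₃ ≡ 0ℤ → q₄ ≡ 0ℤ →
      1ℤ ≡ p₀ * q₀ → A ≡ p₀ * q₁ + p₁ * q₀ → A ≡ p₀ * q₂ + (p₁ * q₁ + p₂ * q₀) →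
      ¬ (1ℤ ≡ p₀ * q₄ + (p₁ * q₃ + (p₂ * q₂ + (p₃ * q₁ + p₄ * q₀))))
    go p₀ p₁ p₂ q₀ q₁ q₂ refl refl refl refl e₀ e₁ e₂ e₄ =
      quadratic-factor p₀ p₁ p₂ q₀ q₁ q₂ (sym e₀) (sym e₁) (sym e₂) (sym (trans e₄ (l₄ p₀ p₁ p₂ q₀ q₁ q₂)))
      where
      l₄ : ∀ p₀ p₁ p₂ q₀ q₁ q₂ → p₀ * 0ℤ + (p₁ * 0ℤ + (p₂ * q₂ + (0ℤ * q₁ + 0ℤ * q₀))) ≡ p₂ * q₂
      l₄ = solve-∀

  quartic-irreducible : IrreducibleSeries (quartic A)
  quartic-irreducible p q (m , p-bounded) (n , q-bounded) e =
      go (exact-degree m p p-bounded) (exact-degree n q q-bounded)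
    where
    go : (∀ i → p i ≡ 0ℤ) ⊎ (∃ λ a → a < m × p a ≢ 0ℤ × Bounded (suc a) p) →
         (∀ i → q i ≡ 0ℤ) ⊎ (∃ λ b → b < n × q b ≢ 0ℤ × Bounded (suc b) q) → Constant p ⊎ Constant q
    go (inj₁ p≡0) _ = inj₁ (λ i → p≡0 (suc i))
    go _ (inj₁ q≡0) = inj₂ (λ i → q≡0 (suc i))
    go (inj₂ (a , _ , pa≢0 , bp)) (inj₂ (b , _ , qb≢0 , bq)) = by-degrees a b a+b≤4 bp bq
      where
      a+b≤4 : a ℕ.+ b ≤ 4
      a+b≤4 with a ℕ.+ b ℕ.≤? 4
      ... | yes le = le
      ... | no  gt = contradiction
        (trans (sym (top-coefficient bp bq)) (trans (sym (at e (a ℕ.+ b))) (quartic-bounded A _ (ℕ.≰⇒> gt))))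
        (λ z → Sum.[ pa≢0 , qb≢0 ] (ℤ.i*j≡0⇒i≡0∨j≡0 (p a) z))
      by-degrees : ∀ a b → a ℕ.+ b ≤ 4 → Bounded (suc a) p → Bounded (suc b) q → Constant p ⊎ Constant q
      by-degrees zero b _ bp bq = inj₁ (λ i → bp (suc i) (s≤s z≤n))
      by-degrees (suc a) zero _ bp bq = inj₂ (λ i → bq (suc i) (s≤s z≤n))
      by-degrees 1 (suc b) (s≤s 1+b≤3) bp bq =
        contradiction e (no-linear-factor p q bp (bounded-mono (s≤s 1+b≤3) bq))
      by-degrees 2 (suc b) (s≤s (s≤s 1+b≤2)) bp bq =
        contradiction e (no-quadratic-factor p q bp (bounded-mono (s≤s 1+b≤2) bq))
      -- The degree sum leaves q linear, so the roles of the factors are exchanged.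
      by-degrees (suc (suc (suc a))) (suc b) (s≤s (s≤s (s≤s a+1+b≤1))) bp bq =
        contradiction (R.trans e (R.*-comm p q)) (no-linear-factor q p
          (bounded-mono (s≤s (ℕ.≤-trans (ℕ.m≤n+m (suc b) a) a+1+b≤1)) bq)
          (bounded-mono (s≤s (s≤s (s≤s (ℕ.≤-trans (ℕ.m<m+n a (s≤s z≤n)) a+1+b≤1)))) bp))

-- Repeated substitution of x² for x

inflates : ℕ → Series → Series
inflates zero    p = p
inflates (suc k) p = inflate (inflates k p)

inflates-0 : ∀ k p → inflates k p 0 ≡ p 0
inflates-0 zero    p = refl
inflates-0 (suc k) p = inflates-0 k p

inflate-bounded : ∀ {n p} → Bounded (suc n) p → Bounded (suc (double n)) (inflate p)
inflate-bounded {n} {p} b i n<i = go (parity i) n<i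
  where
  double-cancel : ∀ {m n} → double m < double n → m < n
  double-cancel {zero}  {suc n} _             = s≤s z≤n
  double-cancel {suc m} {suc n} (s≤s (s≤s l)) = s≤s (double-cancel l)
  go : ∀ {i} → Parity i → suc (double n) ≤ i → inflate p i ≡ 0ℤ
  go (even j) l = trans (evens-inflate p j) (b j (double-cancel l))
  go (odd j)  _ = odds-inflate p j

inflates-degree : ∀ k {d p} → Bounded (suc d) p → p d ≢ 0ℤ →
  ∃ λ e → Bounded (suc e) (inflates k p) × inflates k p e ≢ 0ℤ
inflates-degree zero    b l = _ , b , l
inflates-degree (suc k) b l with inflates-degree k b l
... | e , b′ , l′ = double e , inflate-bounded b′ , λ z → l′ (trans (sym (evens-inflate _ e)) z)

module _ {A} (2∤A : ¬ (+ 2 ∣ₛ A)) where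

  ¬squareMod4-inflates : ∀ k → ¬ SquareMod4 (inflates k (quartic A))
  ¬squareMod4-inflates zero    = ¬squareMod4-quartic 2∤A
  ¬squareMod4-inflates (suc k) s = ¬squareMod4-inflates k (squareMod4-deflate (inflates-0 k (quartic A)) s)

  inflates-irreducible : A ≢ 1ℤ → ∀ k → IrreducibleSeries (inflates k (quartic A))
  inflates-irreducible A≢1 zero    = quartic-irreducible 2∤A
  inflates-irreducible A≢1 (suc k) with inflates-degree k {4} (quartic-bounded A) (λ ())
  ... | e , bounded , lead≢0 = inflate-irreducible {inflates k (quartic A)} {e} (inflates-irreducible A≢1 k)
        (inflates-0 k (quartic A)) lead≢0 bounded (not-norm k)
    where
    not-norm : ∀ k p → Finite p → ¬ (norm p ≈ inflates k (quartic A))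
    not-norm zero    p p-finite e = A≢1 (norm≈quartic⇒A≡1 p-finite e)
    not-norm (suc k) p p-finite e = ¬squareMod4-inflates (suc k) (norm≈inflate⇒squareMod4 p-finite e)

-- Passage to ℚ

-- `toℚ z` normalises by a gcd, which does not compute for a variable z. Over the unnormalised
-- rationals the homomorphism laws become integer identities.
toℚᵘ-toℚ : ∀ z → toℚᵘ (toℚ z) ≃ mkℚᵘ z 0
toℚᵘ-toℚ z = ℚ.toℚᵘ-fromℚᵘ (mkℚᵘ z 0)

toℚ-+ : ∀ a b → toℚ (a + b) ≡ toℚ a +ℚ toℚ b
toℚ-+ a b = ℚ.toℚᵘ-injective (ℚᵘ.≃-trans (toℚᵘ-toℚ (a + b)) (ℚᵘ.≃-trans (*≡* (lemma a b))
  (ℚᵘ.≃-sym (ℚᵘ.≃-trans (ℚ.toℚᵘ-homo-+ (toℚ a) (toℚ b)) (ℚᵘ.+-cong (toℚᵘ-toℚ a) (toℚᵘ-toℚ b))))))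
  where
  lemma : ∀ a b → (a + b) * 1ℤ ≡ (a * 1ℤ + b * 1ℤ) * 1ℤ
  lemma = solve-∀

toℚ-* : ∀ a b → toℚ (a * b) ≡ toℚ a *ℚ toℚ b
toℚ-* a b = ℚ.toℚᵘ-injective (ℚᵘ.≃-trans (toℚᵘ-toℚ (a * b))
  (ℚᵘ.≃-sym (ℚᵘ.≃-trans (ℚ.toℚᵘ-homo-* (toℚ a) (toℚ b)) (ℚᵘ.*-cong (toℚᵘ-toℚ a) (toℚᵘ-toℚ b)))))

toℚ-injective : ∀ {a b} → toℚ a ≡ toℚ b → a ≡ b
toℚ-injective {a} {b} e with ℚᵘ.≃-trans (ℚᵘ.≃-sym (toℚᵘ-toℚ a)) (ℚᵘ.≃-trans (ℚ.toℚᵘ-cong e) (toℚᵘ-toℚ b))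
... | *≡* a1≡b1 = trans (sym (ℤ.*-identityʳ a)) (trans a1≡b1 (ℤ.*-identityʳ b))

toℚ-↧* : ∀ x → toℚ (↧ x) *ℚ x ≡ toℚ (↥ x)
toℚ-↧* x@(mkℚ n d _) = ℚ.toℚᵘ-injective (ℚᵘ.≃-trans (ℚ.toℚᵘ-homo-* (toℚ (↧ x)) x)
  (ℚᵘ.≃-trans (ℚᵘ.*-congʳ (toℚᵘ-toℚ (↧ x))) (ℚᵘ.≃-trans (*≡* eq) (ℚᵘ.≃-sym (toℚᵘ-toℚ n)))))
  where
  eq : (+ suc d * n) * 1ℤ ≡ n * + suc (d ℕ.+ 0)
  eq rewrite ℕ.+-identityʳ d = trans (ℤ.*-identityʳ _) (ℤ.*-comm (+ suc d) n)

toℚ-*-cancel : ∀ {c x} → c ≢ 0ℤ → toℚ c *ℚ x ≡ 0ℚ → x ≡ 0ℚ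
toℚ-*-cancel {c} {x} c≢0 e = ℚ.↥p≡0⇒p≡0 x (Sum.[ (λ c≡0 → contradiction c≡0 c≢0) , (λ z → z) ]
  (ℤ.i*j≡0⇒i≡0∨j≡0 c (toℚ-injective (begin
    toℚ (c * ↥ x)                ≡⟨ toℚ-* c (↥ x) ⟩
    toℚ c *ℚ toℚ (↥ x)           ≡⟨ cong (toℚ c *ℚ_) (toℚ-↧* x) ⟨
    toℚ c *ℚ (toℚ (↧ x) *ℚ x)    ≡⟨ cong (toℚ c *ℚ_) (ℚ.*-comm (toℚ (↧ x)) x) ⟩
    toℚ c *ℚ (x *ℚ toℚ (↧ x))    ≡⟨ ℚ.*-assoc (toℚ c) x (toℚ (↧ x)) ⟨
    toℚ c *ℚ x *ℚ toℚ (↧ x)      ≡⟨ cong (_*ℚ toℚ (↧ x)) e ⟩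
    0ℚ *ℚ toℚ (↧ x)              ≡⟨ ℚ.*-zeroˡ (toℚ (↧ x)) ⟩
    0ℚ                           ∎))))
  where open ≡-Reasoning

coeff-+P : ∀ p q i → coeff (p +P q) i ≡ coeff p i +ℚ coeff q i
coeff-+P []      q       i       = sym (ℚ.+-identityˡ (coeff q i))
coeff-+P (a ∷ p) []      i       = sym (ℚ.+-identityʳ (coeff (a ∷ p) i))
coeff-+P (a ∷ p) (b ∷ q) zero    = refl
coeff-+P (a ∷ p) (b ∷ q) (suc i) = coeff-+P p q i

coeff-map : ∀ a q i → coeff (map (a *ℚ_) q) i ≡ a *ℚ coeff q i
coeff-map a []      i       = sym (ℚ.*-zeroʳ a)
coeff-map a (b ∷ q) zero    = refl
coeff-map a (b ∷ q) (suc i) = coeff-map a q i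

coeff-∷*P : ∀ a p q i → coeff ((a ∷ p) *P q) i ≡ a *ℚ coeff q i +ℚ coeff (0ℚ ∷ (p *P q)) i
coeff-∷*P a p q i = trans (coeff-+P (map (a *ℚ_) q) (0ℚ ∷ (p *P q)) i)
                          (cong (_+ℚ coeff (0ℚ ∷ (p *P q)) i) (coeff-map a q i))

record Scales (c : ℤ) (g : Poly) (p : Series) : Set where
  constructor scaling
  field scaled : ∀ i → toℚ (p i) ≡ toℚ c *ℚ coeff g i
open Scales

clear-denominators : ∀ g → ∃ λ c → ∃ λ p → c ≢ 0ℤ × Finite p × Scales c g p
clear-denominators [] = 1ℤ , (λ _ → 0ℤ) , (λ ()) , (0 , λ _ _ → refl) , scaling (λ _ → refl)
clear-denominators (a ∷ g) with clear-denominators g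
... | c , p , c≢0 , (n , bounded) , scales = ↧ a * c , p′ , ↧ac≢0 , (suc n , bounded′) , scaling scales′
  where
  p′ : Series
  p′ zero    = c * ↥ a
  p′ (suc i) = ↧ a * p i
  ↧ac≢0 : ↧ a * c ≢ 0ℤ
  ↧ac≢0 z = Sum.[ (λ ()) , c≢0 ] (ℤ.i*j≡0⇒i≡0∨j≡0 (↧ a) z)
  bounded′ : Bounded (suc n) p′
  bounded′ (suc i) (s≤s n≤i) = trans (cong (↧ a *_) (bounded i n≤i)) (ℤ.*-zeroʳ (↧ a))
  open ≡-Reasoning
  scales′ : ∀ i → toℚ (p′ i) ≡ toℚ (↧ a * c) *ℚ coeff (a ∷ g) i
  scales′ zero = begin
    toℚ (c * ↥ a)                ≡⟨ toℚ-* c (↥ a) ⟩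
    toℚ c *ℚ toℚ (↥ a)           ≡⟨ cong (toℚ c *ℚ_) (toℚ-↧* a) ⟨
    toℚ c *ℚ (toℚ (↧ a) *ℚ a)    ≡⟨ ℚ.*-assoc (toℚ c) (toℚ (↧ a)) a ⟨
    toℚ c *ℚ toℚ (↧ a) *ℚ a      ≡⟨ cong (_*ℚ a) (trans (ℚ.*-comm (toℚ c) (toℚ (↧ a))) (sym (toℚ-* (↧ a) c))) ⟩
    toℚ (↧ a * c) *ℚ a           ∎
  scales′ (suc i) = begin
    toℚ (↧ a * p i)                      ≡⟨ toℚ-* (↧ a) (p i) ⟩
    toℚ (↧ a) *ℚ toℚ (p i)               ≡⟨ cong (toℚ (↧ a) *ℚ_) (scaled scales i) ⟩
    toℚ (↧ a) *ℚ (toℚ c *ℚ coeff g i)    ≡⟨ ℚ.*-assoc (toℚ (↧ a)) (toℚ c) (coeff g i) ⟨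
    toℚ (↧ a) *ℚ toℚ c *ℚ coeff g i      ≡⟨ cong (_*ℚ coeff g i) (toℚ-* (↧ a) c) ⟨
    toℚ (↧ a * c) *ℚ coeff g i           ∎

scales-* : ∀ {c d} g h {p q} → Scales c g p → Scales d h q → Scales (c * d) (g *P h) (p ⊛ q)
scales-* {c} {d} [] h {p} {q} s t = scaling λ i →
  trans (cong toℚ (⊛-zeroˡ q (λ j → toℚ-injective (trans (scaled s j) (ℚ.*-zeroʳ (toℚ c)))) i))
        (sym (ℚ.*-zeroʳ (toℚ (c * d))))
scales-* {c} {d} (a ∷ g) h {p} {q} s t = scaling λ i → trans (go i)
    (trans (sym (ℚ.*-distribˡ-+ (toℚ (c * d)) (a *ℚ coeff h i) (coeff (0ℚ ∷ (g *P h)) i)))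
           (cong (toℚ (c * d) *ℚ_) (sym (coeff-∷*P a g h i))))
  where
  head-term : ∀ i → toℚ (p 0 * q i) ≡ toℚ (c * d) *ℚ (a *ℚ coeff h i)
  head-term i = trans (toℚ-* (p 0) (q i)) (trans (cong₂ _*ℚ_ (scaled s 0) (scaled t i))
    (trans (interchange (record { isCommutativeSemigroup = record { isSemigroup = ℚ.*-isSemigroup ; comm = ℚ.*-comm } })
              (toℚ c) a (toℚ d) (coeff h i))
           (cong (_*ℚ (a *ℚ coeff h i)) (sym (toℚ-* c d)))))
  go : ∀ i → toℚ ((p ⊛ q) i) ≡ toℚ (c * d) *ℚ (a *ℚ coeff h i) +ℚ toℚ (c * d) *ℚ coeff (0ℚ ∷ (g *P h)) i
  go zero    = trans (head-term 0)
    (sym (trans (cong (toℚ (c * d) *ℚ (a *ℚ coeff h 0) +ℚ_) (ℚ.*-zeroʳ (toℚ (c * d)))) (ℚ.+-identityʳ _)))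
  go (suc i) = trans (toℚ-+ (p 0 * q (suc i)) ((tail p ⊛ q) i))
    (cong₂ _+ℚ_ (head-term (suc i)) (scaled (scales-* g h (scaling {c} {g} {tail p} (λ j → scaled s (suc j))) t) i))

record Represents (g : Poly) (p : Series) : Set where
  constructor representing
  field represented : ∀ i → coeff g i ≡ toℚ (p i)
open Represents

represents⇒scales : ∀ {g p} → Represents g p → Scales 1ℤ g p
represents⇒scales {g} r = scaling λ i → trans (sym (represented r i)) (sym (ℚ.*-identityˡ (coeff g i)))

toPoly : ℕ → Series → Poly
toPoly zero    p = []
toPoly (suc n) p = toℚ (p 0) ∷ toPoly n (tail p)

represents-toPoly : ∀ n p → Bounded n p → Represents (toPoly n p) p
represents-toPoly n p b = representing (go n p b)
  where
  go : ∀ n p → Bounded n p → ∀ i → coeff (toPoly n p) i ≡ toℚ (p i)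
  go zero    p b i       = cong toℚ (sym (b i z≤n))
  go (suc n) p b zero    = refl
  go (suc n) p b (suc i) = go n (tail p) (λ j n≤j → b (suc j) (s≤s n≤j)) i

represents-* : ∀ {g h p q} → Represents g p → Represents h q → Represents (g *P h) (p ⊛ q)
represents-* {g} {h} r r′ = representing λ i → trans (sym (ℚ.*-identityˡ _))
  (sym (scaled (scales-* g h (represents⇒scales r) (represents⇒scales r′)) i))

constant-scaled : ∀ {c g p} → c ≢ 0ℤ → Scales c g p → Constant p → IsConstant g
constant-scaled c≢0 s p-constant i = toℚ-*-cancel c≢0 (trans (sym (scaled s (suc i))) (cong toℚ (p-constant i)))

isConstant-represents : ∀ {g p} → Represents g p → IsConstant g → Constant p
isConstant-represents r g-constant i = toℚ-injective (trans (sym (represented r (suc i))) (g-constant i))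

-- Clearing denominators in f = g h gives c d p = s t over ℤ. `gauss` absorbs the multiplier c d,
-- and constancy of a rescaled factor returns to g or h because the zero coefficients are the same.
irreducible-transfer : ∀ {f p} → Represents f p → ¬ Constant p → IrreducibleSeries p → Irreducible f
irreducible-transfer {f} {p} r p-nonconstant p-irreducible =
  (λ f-constant → p-nonconstant (isConstant-represents r f-constant)) , factor
  where
  factor : ∀ g h → f ≈P (g *P h) → IsConstant g ⊎ IsConstant h
  factor g h f≈gh = go (clear-denominators g) (clear-denominators h)
    where
    go : (∃ λ c → ∃ λ s → c ≢ 0ℤ × Finite s × Scales c g s) →
         (∃ λ d → ∃ λ t → d ≢ 0ℤ × Finite t × Scales d h t) → IsConstant g ⊎ IsConstant h
    go (c , s , c≢0 , (m , s-bounded) , s-scales) (d , t , d≢0 , (n , t-bounded) , t-scales) =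
      conclude (gauss s t (λ z → Sum.[ c≢0 , d≢0 ] (ℤ.i*j≡0⇒i≡0∨j≡0 c z)) (m , s-bounded) ⟨ cdp≡st ⟩)
      where
      cdp≡st : ∀ i → (const (c * d) ⊛ p) i ≡ (s ⊛ t) i
      cdp≡st i = trans (const-⊛ (c * d) p i) (toℚ-injective (begin
        toℚ (c * d * p i)                  ≡⟨ toℚ-* (c * d) (p i) ⟩
        toℚ (c * d) *ℚ toℚ (p i)           ≡⟨ cong (toℚ (c * d) *ℚ_) (trans (sym (represented r i)) (f≈gh i)) ⟩
        toℚ (c * d) *ℚ coeff (g *P h) i    ≡⟨ scaled (scales-* g h s-scales t-scales) i ⟨
        toℚ ((s ⊛ t) i)                    ∎))
        where open ≡-Reasoning
      conclude : Primitivised p s t → IsConstant g ⊎ IsConstant h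
      conclude (s′ , t′ , p≈s′t′ , zs , zt) = Sum.map
        (λ s′-constant → constant-scaled c≢0 s-scales (sameZeros-constant zs s′-constant))
        (λ t′-constant → constant-scaled d≢0 t-scales (sameZeros-constant zt t′-constant))
        (p-irreducible s′ t′ (m , λ i m≤i → proj₁ (zs i) (s-bounded i m≤i))
                             (n , λ i n≤i → proj₁ (zt i) (t-bounded i n≤i)) p≈s′t′)

reducible-transfer : ∀ {f p q} → Finite p → Finite q → Represents f (p ⊛ q) → Irreducible f → Constant p ⊎ Constant q
reducible-transfer {f} {p} {q} (m , p-bounded) (n , q-bounded) r (_ , factors) =
  Sum.map (isConstant-represents rp) (isConstant-represents rq)
    (factors (toPoly m p) (toPoly n q)
      (λ i → trans (represented r i) (sym (represented (represents-* rp rq) i))))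
  where
  rp = represents-toPoly m p p-bounded
  rq = represents-toPoly n q q-bounded

represents-⊕ : ∀ {g h p q} → Represents g p → Represents h q → Represents (g +P h) (p ⊕ q)
represents-⊕ {g} {h} {p} {q} r r′ = representing λ i → trans (coeff-+P g h i)
  (trans (cong₂ _+ℚ_ (represented r i) (represented r′ i)) (sym (toℚ-+ (p i) (q i))))

represents-≈ : ∀ {g p q} → p ≈ q → Represents g p → Represents g q
represents-≈ e r = representing λ i → trans (represented r i) (cong toℚ (at e i))

-- `F` as a repeated substitution into the quartic

power : ℤ → ℕ → Series
power c zero    = const c
power c (suc m) = shift (power c m)

represents-monomial : ∀ c m → Represents (monomial (toℚ c) m) (power c m)
represents-monomial c m = representing (go m)
  where
  go : ∀ m i → coeff (monomial (toℚ c) m) i ≡ toℚ (power c m i)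
  go zero    zero    = refl
  go zero    (suc i) = refl
  go (suc m) zero    = refl
  go (suc m) (suc i) = go m i

inflate-cong : ∀ {p q} → p ≈ q → inflate p ≈ inflate q
inflate-cong {p} {q} e = by-parity
  (λ i → trans (evens-inflate p i) (trans (at e i) (sym (evens-inflate q i))))
  (λ i → trans (odds-inflate p i) (sym (odds-inflate q i)))

inflate-⊕ : ∀ p q → inflate (p ⊕ q) ≈ inflate p ⊕ inflate q
inflate-⊕ p q = by-parity
  (λ i → trans (evens-inflate (p ⊕ q) i) (sym (cong₂ _+_ (evens-inflate p i) (evens-inflate q i))))
  (λ i → trans (odds-inflate (p ⊕ q) i) (sym (cong₂ _+_ (odds-inflate p i) (odds-inflate q i))))

inflate-⊛ : ∀ p q → inflate (p ⊛ q) ≈ inflate p ⊛ inflate q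
inflate-⊛ p q = by-parity
  (λ i → begin
    evens (inflate (p ⊛ q)) i
      ≡⟨ evens-inflate (p ⊛ q) i ⟩
    (p ⊛ q) i
      ≡⟨ at (⊛-cong {evens (inflate p)} {p} ⟨ evens-inflate p ⟩ ⟨ evens-inflate q ⟩) i ⟨
    (evens (inflate p) ⊛ evens (inflate q)) i
      ≡⟨ ℤ.+-identityʳ _ ⟨
    (evens (inflate p) ⊛ evens (inflate q)) i + 0ℤ
      ≡⟨ cong (λ z → (evens (inflate p) ⊛ evens (inflate q)) i + z) (odd-product i) ⟨
    (evens (inflate p) ⊛ evens (inflate q)) i + shift (odds (inflate p) ⊛ odds (inflate q)) i
      ≡⟨ evens-⊛ (inflate p) (inflate q) i ⟨
    evens (inflate p ⊛ inflate q) i ∎)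
  (λ i → trans (odds-inflate (p ⊛ q) i) (sym (trans (odds-⊛ (inflate p) (inflate q) i)
    (cong₂ _+_ (trans (⊛-comm (evens (inflate p)) (odds (inflate q)) i) (⊛-zeroˡ _ (odds-inflate q) i))
               (⊛-zeroˡ _ (odds-inflate p) i)))))
  where
  open ≡-Reasoning
  odd-product : ∀ i → shift (odds (inflate p) ⊛ odds (inflate q)) i ≡ 0ℤ
  odd-product zero    = refl
  odd-product (suc i) = ⊛-zeroˡ _ (odds-inflate p) i

inflate-power : ∀ c m → inflate (power c m) ≈ power c (double m)
inflate-power c m = ⟨ go m ⟩
  where
  go : ∀ m i → inflate (power c m) i ≡ power c (double m) i
  go zero    zero          = refl
  go zero    (suc zero)    = refl
  go zero    (suc (suc i)) = vanishing i
    where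
    vanishing : ∀ i → inflate (λ _ → 0ℤ) i ≡ 0ℤ
    vanishing zero          = refl
    vanishing (suc zero)    = refl
    vanishing (suc (suc i)) = vanishing i
  go (suc m) zero          = refl
  go (suc m) (suc zero)    = refl
  go (suc m) (suc (suc i)) = go m i

F-series : ℕ → ℤ → Series
F-series n A = power 1ℤ (2 ^ n)
           ⊕ (power A (3 ℕ.* 2 ^ (n ∸ 2)) ⊕ (power A (2 ^ (n ∸ 1)) ⊕ (power A (2 ^ (n ∸ 2)) ⊕ power 1ℤ 0)))

represents-F : ∀ n A → Represents (F n A) (F-series n A)
represents-F n A = represents-⊕ (represents-monomial 1ℤ (2 ^ n))
  (represents-⊕ (represents-monomial A (3 ℕ.* 2 ^ (n ∸ 2)))
  (represents-⊕ (represents-monomial A (2 ^ (n ∸ 1)))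
  (represents-⊕ (represents-monomial A (2 ^ (n ∸ 2))) (represents-monomial 1ℤ 0))))

-- Each substitution doubles every exponent. The induction starts at n = 2, where the polynomial is
-- the quartic itself.
F-series≈inflates : ∀ k A → F-series (2 ℕ.+ k) A ≈ inflates k (quartic A)
F-series≈inflates zero    A = ⟨ (λ
  { 0 → refl
  ; 1 → trans (ℤ.+-identityˡ _) (trans (ℤ.+-identityˡ _) (trans (ℤ.+-identityˡ _) (ℤ.+-identityʳ A)))
  ; 2 → trans (ℤ.+-identityˡ _) (trans (ℤ.+-identityˡ _) (ℤ.+-identityʳ A))
  ; 3 → trans (ℤ.+-identityˡ _) (ℤ.+-identityʳ A)
  ; 4 → refl
  ; (suc (suc (suc (suc (suc i))))) → refl
  }) ⟩
F-series≈inflates (suc k) A = R.trans (R.sym doubled) (inflate-cong (F-series≈inflates k A))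
  where
  double≡2* : ∀ m → double m ≡ 2 ℕ.* m
  double≡2* m = trans (double≡+ m) (cong (m ℕ.+_) (sym (ℕ.+-identityʳ m)))
  scale : ∀ c m {n} → 2 ℕ.* m ≡ n → inflate (power c m) ≈ power c n
  scale c m e = R.trans (inflate-power c m) (R.reflexive (cong (power c) (trans (double≡2* m) e)))
  2*3*≡3*2* : ∀ m → 2 ℕ.* (3 ℕ.* m) ≡ 3 ℕ.* (2 ℕ.* m)
  2*3*≡3*2* m = trans (sym (ℕ.*-assoc 2 3 m)) (ℕ.*-assoc 3 2 m)
  inflate-⊕₂ : ∀ {p q p′ q′} → inflate p ≈ p′ → inflate q ≈ q′ → inflate (p ⊕ q) ≈ p′ ⊕ q′
  inflate-⊕₂ {p} {q} e e′ = R.trans (inflate-⊕ p q) (R.+-cong e e′)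
  doubled : inflate (F-series (2 ℕ.+ k) A) ≈ F-series (3 ℕ.+ k) A
  doubled = inflate-⊕₂ (scale 1ℤ (2 ^ (2 ℕ.+ k)) refl)
    (inflate-⊕₂ (scale A (3 ℕ.* 2 ^ k) (2*3*≡3*2* (2 ^ k)))
    (inflate-⊕₂ (scale A (2 ^ (1 ℕ.+ k)) refl)
    (inflate-⊕₂ (scale A (2 ^ k) refl) (scale 1ℤ 0 refl))))

-- Nonconstant factors and the factorisation for A = 1

inflates-nonconstant : ∀ k {p} → ¬ Constant p → ¬ Constant (inflates k p)
inflates-nonconstant zero    nc = nc
inflates-nonconstant (suc k) {p} nc c =
  inflates-nonconstant k {p} nc λ i → trans (sym (evens-inflate (inflates k p) (suc i))) (c (suc (double i)))

inflates-finite : ∀ k {n p} → Bounded (suc n) p → Finite (inflates k p)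
inflates-finite k b = let e , b′ = go k b in suc e , b′
  where
  go : ∀ k {n p} → Bounded (suc n) p → ∃ λ e → Bounded (suc e) (inflates k p)
  go zero    b = _ , b
  go (suc k) b = let e , b′ = go k b in double e , inflate-bounded b′

-- quartic 1 is Φ₅(x), and this is Φ₅(−x).
alternating : Series
alternating 0 = 1ℤ
alternating 1 = - 1ℤ
alternating 2 = 1ℤ
alternating 3 = - 1ℤ
alternating 4 = 1ℤ
alternating _ = 0ℤ

alternating-bounded : Bounded 5 alternating
alternating-bounded _ (s≤s (s≤s (s≤s (s≤s (s≤s z≤n))))) = refl

inflate-quartic-1 : inflate (quartic 1ℤ) ≈ quartic 1ℤ ⊛ alternating
inflate-quartic-1 = ⟨ (λ
  { 0 → refl ; 1 → refl ; 2 → refl ; 3 → refl ; 4 → refl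
  ; 5 → refl ; 6 → refl ; 7 → refl ; 8 → refl ; 9 → refl
  -- `bounded-⊛` bounds the product by 5 + 5, so ten coefficients are evaluated and from index 10 on
  -- both sides vanish.
  ; (suc (suc (suc (suc (suc (suc (suc (suc (suc (suc i)))))))))) →
      trans (inflate-bounded (quartic-bounded 1ℤ) (10 ℕ.+ i) (ℕ.m≤m+n 9 (suc i)))
            (sym (bounded-⊛ {q = alternating} (quartic-bounded 1ℤ) alternating-bounded (10 ℕ.+ i) (ℕ.m≤m+n 10 i)))
  }) ⟩

inflates-quartic-1 : ∀ k → inflates (suc k) (quartic 1ℤ) ≈ inflates k (quartic 1ℤ) ⊛ inflates k alternating
inflates-quartic-1 zero    = inflate-quartic-1
inflates-quartic-1 (suc k) = R.trans (inflate-cong (inflates-quartic-1 k))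
                                     (inflate-⊛ (inflates k (quartic 1ℤ)) (inflates k alternating))

quartic-nonconstant : ∀ A → ¬ Constant (quartic A)
quartic-nonconstant A c = contradiction (c 3) λ ()

reducible-at-1 : ∀ k → ¬ Irreducible (F (3 ℕ.+ k) 1ℤ)
reducible-at-1 k f-irreducible = Sum.[ inflates-nonconstant k {quartic 1ℤ} (quartic-nonconstant 1ℤ)
                                     , inflates-nonconstant k {alternating} (λ c → contradiction (c 3) λ ()) ]
  (reducible-transfer (inflates-finite k (quartic-bounded 1ℤ)) (inflates-finite k alternating-bounded)
    (represents-≈ (R.trans (F-series≈inflates (suc k) 1ℤ) (inflates-quartic-1 k)) (represents-F (3 ℕ.+ k) 1ℤ))
    f-irreducible)

4∣A-1⇒2∤A : ∀ {A} → + 4 ∣ A - 1ℤ → ¬ (+ 2 ∣ₛ A)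
4∣A-1⇒2∤A {A} 4∣A-1 2∣A = 2∣1⇒⊥ (subst (+ 2 ∣ₛ_) (lemma A) (∣m∣n⇒∣m-n 2∣A (4∣⇒2∣ (∣ᵤ⇒∣ 4∣A-1))))
  where
  lemma : ∀ A → A - (A - 1ℤ) ≡ 1ℤ
  lemma = solve-∀

theorem1p2 : (A : ℤ) → (+ 4) ∣ (A - + 1) → (n : ℕ) → 3 ≤ n →
    Irreducible (F n A) ⇔ (A ≢ + 1)
theorem1p2 A 4∣A-1 (suc (suc (suc k))) (s≤s (s≤s (s≤s z≤n))) = mk⇔
  (λ { f-irreducible refl → reducible-at-1 k f-irreducible })
  (λ A≢1 → irreducible-transfer
    (represents-≈ (F-series≈inflates (suc k) A) (represents-F (3 ℕ.+ k) A))
    (inflates-nonconstant (suc k) {quartic A} (quartic-nonconstant A))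
    (inflates-irreducible (4∣A-1⇒2∤A 4∣A-1) A≢1 (suc k)))
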